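{- Let $n,k,\ell$ be positive integers with $n>k\ell$, and suppose that $\mathcal{F}\subseteq[n]^{(k)}$ and $\mathcal{G}\subseteq[n]^{(\ell)}$ are cross-intersecting. Then there is some $i\in[n]$ such that $\vert\partial(\mathcal{F}(i))\vert\geq\vert\mathcal{F}(i)\vert$ or $\vert\partial(\mathcal{G}(i))\vert\geq\vert\mathcal{G}(i)\vert$.
   Context: $[n]=\{1,\dots,n\}$ and $X^{(k)}$ denotes the set of $k$-element subsets of $X$. Families $\mathcal{F},\mathcal{G}$ are cross-intersecting if $F\cap G\neq\emptyset$ for every $F\in\mathcal{F}$, $G\in\mathcal{G}$. The shadow of a family $\mathcal{H}$ is $\partial\mathcal{H}=\{H\setminus\{x\}: x\in H\in\mathcal{H}\}$. For $i\in[n]$, the link is $\mathcal{F}(i)=\{F\setminus\{i\}: i\in F\in\mathcal{F}\}$ (similarly for $\mathcal{G}$). -}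

module Defs where

open import Data.Nat using (ℕ; zero; suc)
open import Data.Bool using (Bool; true; false; not; _∧_)
open import Data.Fin using (Fin)
open import Data.Fin.Subset using (Subset; _∪_; _∩_; ⁅_⁆; Nonempty; ∣_∣)
open import Data.Fin.Subset.Properties using (_∈?_)
open import Data.Vec using ([]; _∷_)
open import Data.Bool.ListAction using (any)
open import Data.List using (List; []; _∷_; _++_; map; allFin; length; filter)
open import Relation.Nullary.Decidable using (⌊_⌋)
open import Relation.Binary.PropositionalEquality using (_≡_)

Family : ℕ → Set
Family n = Subset n → Bool

allSubsets : (n : ℕ) → List (Subset n)
allSubsets zero = [] ∷ []
allSubsets (suc n) = map (false ∷_) (allSubsets n) ++ map (true ∷_) (allSubsets n)

card : ∀ {n} → Family n → ℕ
card {n} 𝓕 = length (filter (λ A → 𝓕 A ≡? true) (allSubsets n))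
  where
  open import Data.Bool.Properties using () renaming (_≟_ to _≡?_)

Uniform : ∀ {n} → ℕ → Family n → Set
Uniform k 𝓕 = ∀ A → 𝓕 A ≡ true → ∣ A ∣ ≡ k

CrossIntersecting : ∀ {n} → Family n → Family n → Set
CrossIntersecting 𝓕 𝓖 = ∀ A B → 𝓕 A ≡ true → 𝓖 B ≡ true → Nonempty (A ∩ B)

-- shadow: A ∈ ∂𝓗 iff A = H ∖ {x} for some x ∈ H ∈ 𝓗,
-- i.e. iff there is x ∉ A with A ∪ {x} ∈ 𝓗.
shadow : ∀ {n} → Family n → Family n
shadow {n} 𝓗 A = any (λ x → not ⌊ x ∈? A ⌋ ∧ 𝓗 (A ∪ ⁅ x ⁆)) (allFin n)

-- link: 𝓕(i) = { F ∖ {i} : i ∈ F ∈ 𝓕 }, viewed as a family of subsets of [n]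
-- (its members avoid i); A ∈ 𝓕(i) iff i ∉ A and A ∪ {i} ∈ 𝓕.
link : ∀ {n} → Family n → Fin n → Family n
link 𝓕 i A = not ⌊ i ∈? A ⌋ ∧ 𝓕 (A ∪ ⁅ i ⁆)

{-# OPTIONS --safe #-}
module Submission where

-- Suppose every link is bad: its shadow is smaller than itself. Adjacent shifts preserve sizes and
-- cross-intersection and do not enlarge shadows. A family whose members all contain at least
-- α (t + 1) / (α + β) points of some initial segment [t] satisfies α |F| ≤ β |∂F|: apply the local LYM inequality on the
-- longest such segment. Hence a bad b-uniform family, once shifted, contains a set with at most t / 2 points in
-- every [t], and then a family K cross-intersecting it satisfies (b + 1) |K| ≤ b |∂K|.
-- Apply this to K = {F ∈ 𝓕 : i ∉ F} and the link 𝓖(i), and sum over i. With Σ |𝓕(i)| = k |𝓕| and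
-- Σ |∂(𝓕(i))| = (k - 1) |∂𝓕| this gives n ≤ k ℓ when k > ℓ, and the case k < ℓ is symmetric.
-- When k = ℓ ≥ 2 a sharper count gives (n - k² + k) |𝓕| ≤ n C(2k-2, k), and the same for 𝓖. In the other direction,
-- for all i ≠ j the double links satisfy 4 (|𝓕(i, j)| + |𝓖(i, j)|) ≥ C(2k-2, k-1): either both are bad, or one is
-- not and then the expansion inequality makes the other large; sizes come from Kruskal–Katona. Summing over i ≠ j
-- gives k² (k + 1) ≤ 8 (k - 1)², which is false. The case k = ℓ = 1 follows from the first inequality alone.

open import Defs
open import Data.Nat using (ℕ; _*_; _<_; _≥_; NonZero)
open import Data.Fin using (Fin)
open import Data.Product using (∃)
open import Data.Sum using (_⊎_)
open import Algebra.Properties.CommutativeSemigroup using (interchange)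
open import Data.Bool using (Bool; true; false; not; _∧_; _∨_; if_then_else_)
open import Data.Bool.ListAction using (any)
open import Data.Bool.Properties using (∨-identityʳ) renaming (_≟_ to _≡?_)
open import Data.Empty using (⊥; ⊥-elim)
open import Data.Fin using (zero; suc)
open import Data.Fin.Properties using (_≟_; any?)
open import Data.Fin.Subset using (Subset; ∣_∣; ⁅_⁆; _∪_)
open import Data.Fin.Subset.Properties using (∣p∣≤n; x∈p∩q⁻; ∪-identityʳ; _∈?_)
open import Data.List using (List; []; _∷_; _++_; map; filter; length; tabulate)
open import Data.List.Properties using (length-++; filter-++)
open import Data.Nat using (zero; suc; _+_; _∸_; _≤_; z≤n; s≤s; z<s; >-nonZero; _≤?_; _<?_)
open import Data.Nat.Induction using (<-wellFounded)
open import Data.Nat.Properties hiding (_≟_)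
open import Data.Nat.Tactic.RingSolver using (solve-∀)
open import Data.Product using (_×_; _,_; proj₁; proj₂)
open import Data.Sum using (inj₁; inj₂; [_,_]′)
open import Data.Unit using (⊤; tt)
open import Data.Vec using ([]; _∷_; lookup; _[_]≔_)
open import Data.Vec.Properties using ([]=⇒lookup; lookup∘update′)
open import Function using (_∘_)
open import Induction.WellFounded using (Acc; acc)
open import Relation.Binary.Definitions using (tri<; tri≈; tri>)
open import Relation.Binary.PropositionalEquality
open import Relation.Nullary using (¬_; yes; no; contradiction)
open import Relation.Nullary.Decidable using (⌊_⌋; _⊎-dec_)

-- Families as Boolean predicates: sizes, shadows, uniformity, disjointness

private variable
  n : ℕ

infix 4 _∋_ _⊑_
infixl 8 _↾_

_∋_ : Family n → Subset n → Set
F ∋ A = F A ≡ true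

_⊑_ : Family n → Family n → Set
F ⊑ G = ∀ A → F ∋ A → G ∋ A

_↾_ : Family (suc n) → Bool → Family n
(F ↾ x) A = F (x ∷ A)

size : Family n → ℕ
size {zero}  F = if F [] then 1 else 0
size {suc n} F = size (F ↾ false) + size (F ↾ true)

-- The shadow by recursion on the head: a shadow set without the head arises by removing a later
-- point or the head itself, one with the head only by removing a later point.
∂ : Family n → Family n
∂ F []          = false
∂ F (false ∷ A) = ∂ (F ↾ false) A ∨ F (true ∷ A)
∂ F (true ∷ A)  = ∂ (F ↾ true) A

Bad : Family n → Set
Bad F = size (∂ F) < size F

∨-elim : ∀ {a b} → a ∨ b ≡ true → a ≡ true ⊎ b ≡ true
∨-elim {true}  e = inj₁ refl
∨-elim {false} e = inj₂ e

∨-introˡ : ∀ {a b} → a ≡ true → a ∨ b ≡ true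
∨-introˡ refl = refl

∨-introʳ : ∀ {a b} → b ≡ true → a ∨ b ≡ true
∨-introʳ {true}  e = refl
∨-introʳ {false} e = e

∧-elim : ∀ {a b} → a ∧ b ≡ true → a ≡ true × b ≡ true
∧-elim {true} e = refl , e

∧-intro : ∀ {a b} → a ≡ true → b ≡ true → a ∧ b ≡ true
∧-intro refl e = e

size-mono : {F G : Family n} → F ⊑ G → size F ≤ size G
size-mono {zero} {F} {G} F⊑G with F [] in eF | G [] in eG
... | false | _     = z≤n
... | true  | true  = ≤-refl
... | true  | false = contradiction (trans (sym eG) (F⊑G [] eF)) λ ()
size-mono {suc n} F⊑G =
  +-mono-≤ (size-mono λ A → F⊑G (false ∷ A)) (size-mono λ A → F⊑G (true ∷ A))

-- A shift replaces two sections by their union and intersection, so this identity is what makes it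
-- preserve size.
size-∨-∧ : (F G : Family n) →
  size (λ A → F A ∨ G A) + size (λ A → F A ∧ G A) ≡ size F + size G
size-∨-∧ {zero} F G with F [] | G []
... | false | false = refl
... | false | true  = refl
... | true  | false = refl
... | true  | true  = refl
size-∨-∧ {suc n} F G = trans
  (interchange +-commutativeSemigroup (size λ A → F (false ∷ A) ∨ G (false ∷ A)) (size λ A → F (true ∷ A) ∨ G (true ∷ A)) _ _)
  (trans (cong₂ _+_ (size-∨-∧ (F ↾ false) (G ↾ false)) (size-∨-∧ (F ↾ true) (G ↾ true)))
         (interchange +-commutativeSemigroup (size (F ↾ false)) (size (G ↾ false)) _ _))

0<size⇒∃ : (F : Family n) → 0 < size F → ∃ λ A → F ∋ A
0<size⇒∃ {zero} F p with F [] in eF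
... | true = [] , eF
0<size⇒∃ {suc n} F p with size (F ↾ false) in e₀
... | suc m = let A , FA = 0<size⇒∃ (F ↾ false) (subst (0 <_) (sym e₀) z<s) in false ∷ A , FA
... | zero  = let A , FA = 0<size⇒∃ (F ↾ true) p in true ∷ A , FA

∃⇒0<size : (F : Family n) (A : Subset n) → F ∋ A → 0 < size F
∃⇒0<size F [] FA rewrite FA = z<s
∃⇒0<size F (false ∷ A) FA = <-≤-trans (∃⇒0<size (F ↾ false) A FA) (m≤m+n _ _)
∃⇒0<size F (true ∷ A)  FA = <-≤-trans (∃⇒0<size (F ↾ true) A FA) (m≤n+m _ _)

empty⇒size≡0 : (F : Family n) → (∀ A → ¬ F ∋ A) → size F ≡ 0
empty⇒size≡0 F none with size F in e
... | zero  = refl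
... | suc m = let A , FA = 0<size⇒∃ F (subst (0 <_) (sym e) z<s) in contradiction FA (none A)

∂-mono : {F G : Family n} → F ⊑ G → ∂ F ⊑ ∂ G
∂-mono F⊑G (true ∷ A)  h = ∂-mono (λ B → F⊑G (true ∷ B)) A h
∂-mono F⊑G (false ∷ A) h with ∨-elim h
... | inj₁ p = ∨-introˡ (∂-mono (λ B → F⊑G (false ∷ B)) A p)
... | inj₂ p = ∨-introʳ (F⊑G (true ∷ A) p)

∂-here : (F : Family (suc n)) (A : Subset n) → F ∋ (true ∷ A) → ∂ F ∋ (false ∷ A)
∂-here F A = ∨-introʳ {∂ (F ↾ false) A}

∂-there : (F : Family (suc n)) (A : Subset n) → ∂ (F ↾ false) ∋ A → ∂ F ∋ (false ∷ A)
∂-there F A = ∨-introˡ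

∂-elim : (F : Family (suc n)) (A : Subset n) → ∂ F ∋ (false ∷ A) → ∂ (F ↾ false) ∋ A ⊎ F ∋ (true ∷ A)
∂-elim F A = ∨-elim

uniform-↾false : ∀ {k} {F : Family (suc n)} → Uniform k F → Uniform k (F ↾ false)
uniform-↾false U A = U (false ∷ A)

uniform-↾true : ∀ {k} {F : Family (suc n)} → Uniform (suc k) F → Uniform k (F ↾ true)
uniform-↾true U A h = suc-injective (U (true ∷ A) h)

uniform-0-↾true : {F : Family (suc n)} → Uniform 0 F → ∀ A → ¬ (F ↾ true) ∋ A
uniform-0-↾true U A h with U (true ∷ A) h
... | ()

∂-source : (F : Family n) → ∀ A → ∂ F ∋ A → ∃ λ B → F ∋ B × ∣ B ∣ ≡ suc ∣ A ∣
∂-source F (true ∷ A) h =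
  let B , FB , e = ∂-source (F ↾ true) A h in true ∷ B , FB , cong suc e
∂-source F (false ∷ A) h with ∨-elim h
... | inj₁ p = let B , FB , e = ∂-source (F ↾ false) A p in false ∷ B , FB , e
... | inj₂ p = true ∷ A , p , refl

∂-uniform : ∀ {k} {F : Family n} → Uniform (suc k) F → Uniform k (∂ F)
∂-uniform {F = F} U A h =
  let B , FB , e = ∂-source F A h in suc-injective (trans (sym e) (U B FB))

Disjoint : Subset n → Subset n → Set
Disjoint A B = ∀ x → lookup A x ≡ true → lookup B x ≡ true → ⊥

disjoint-[] : Disjoint [] []
disjoint-[] ()

disjoint-∷ : ∀ {x y} {A B : Subset n} → x ∧ y ≡ false → Disjoint A B → Disjoint (x ∷ A) (y ∷ B)
disjoint-∷ {x = true} {y = true} () D zero refl refl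
disjoint-∷ e D (suc i) = D i

-- Negative form of cross-intersection: the arguments below contradict it by producing disjoint
-- members.
Cross : Family n → Family n → Set
Cross F G = ∀ A B → F ∋ A → G ∋ B → ¬ Disjoint A B

-- Shifting

-- The pattern that a shift leaves keeps a tail only if both versions are present (intersection);
-- the pattern that it enters takes either version (union).
op : Bool → Bool → Bool → Bool
op true  = _∧_
op false = _∨_

-- At positions p and p + 1, the pattern (d , not d) is replaced by (not d , d) unless that set is already present.
-- So shift true moves elements towards the end of the vector and shift false towards its head.
shift : Bool → ℕ → Family n → Family n
shift d p F [] = F []
shift d (suc p) F (x ∷ A) = shift d p (F ↾ x) A
shift d zero F (x ∷ []) = F (x ∷ [])
shift d zero F (false ∷ false ∷ A) = F (false ∷ false ∷ A)
shift d zero F (true  ∷ true  ∷ A) = F (true ∷ true ∷ A)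
shift d zero F (true  ∷ false ∷ A) = op d (F (true ∷ false ∷ A)) (F (false ∷ true ∷ A))
shift d zero F (false ∷ true  ∷ A) = op (not d) (F (true ∷ false ∷ A)) (F (false ∷ true ∷ A))

op-size : ∀ d (F G : Family n) →
  size (λ A → op (not d) (F A) (G A)) + size (λ A → op d (F A) (G A)) ≡ size F + size G
op-size true  F G = size-∨-∧ F G
op-size false F G = trans (+-comm (size λ A → F A ∧ G A) _) (size-∨-∧ F G)

shift-size : ∀ d p (F : Family n) → size (shift d p F) ≡ size F
shift-size {zero}  d p F = refl
shift-size {suc n} d (suc p) F = cong₂ _+_ (shift-size d p (F ↾ false)) (shift-size d p (F ↾ true))
shift-size {suc zero} d zero F = refl
shift-size {suc (suc n)} d zero F =
  trans (regroup (size (F ↾ false ↾ false)) _ _ _)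
  (trans (cong (λ s → size (F ↾ false ↾ false) + s + size (F ↾ true ↾ true))
               (op-size d (F ↾ true ↾ false) (F ↾ false ↾ true)))
         (regroup′ (size (F ↾ false ↾ false)) _ _ _))
  where
  regroup : ∀ a b c e → (a + b) + (c + e) ≡ a + (b + c) + e
  regroup = solve-∀
  regroup′ : ∀ a b c e → a + (c + b) + e ≡ (a + b) + (c + e)
  regroup′ = solve-∀

op-true : ∀ d {a b} → op d a b ≡ true → a ≡ true ⊎ b ≡ true
op-true true  e = inj₁ (proj₁ (∧-elim e))
op-true false e = ∨-elim e

op-mono : ∀ d {a b a′ b′} → (a ≡ true → a′ ≡ true) → (b ≡ true → b′ ≡ true) →
  op d a b ≡ true → op d a′ b′ ≡ true
op-mono true  f g e = let p , q = ∧-elim e in ∧-intro (f p) (g q)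
op-mono false f g e with ∨-elim e
... | inj₁ p = ∨-introˡ (f p)
... | inj₂ q = ∨-introʳ (g q)

op-intro : ∀ d {a b} → a ≡ true → b ≡ true → op d a b ≡ true
op-intro true  = ∧-intro
op-intro false = λ p _ → ∨-introˡ p

shift-source : ∀ d p (F : Family n) A → shift d p F ∋ A → ∃ λ B → F ∋ B × ∣ B ∣ ≡ ∣ A ∣
shift-source d p F [] h = [] , h , refl
shift-source d (suc p) F (x ∷ A) h with shift-source d p (F ↾ x) A h
shift-source d (suc p) F (false ∷ A) h | B , FB , e = false ∷ B , FB , e
shift-source d (suc p) F (true ∷ A)  h | B , FB , e = true ∷ B , FB , cong suc e
shift-source d zero F (x ∷ []) h = x ∷ [] , h , refl
shift-source d zero F (false ∷ false ∷ A) h = _ , h , refl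
shift-source d zero F (true ∷ true ∷ A) h = _ , h , refl
shift-source d zero F (true ∷ false ∷ A) h with op-true d h
... | inj₁ q = _ , q , refl
... | inj₂ q = _ , q , refl
shift-source d zero F (false ∷ true ∷ A) h with op-true (not d) h
... | inj₁ q = _ , q , refl
... | inj₂ q = _ , q , refl

shift-uniform : ∀ d p {k} {F : Family n} → Uniform k F → Uniform k (shift d p F)
shift-uniform d p {F = F} U A h = let B , FB , e = shift-source d p F A h in trans (sym e) (U B FB)

shift-mono : ∀ d p {F G : Family n} → F ⊑ G → shift d p F ⊑ shift d p G
shift-mono d p F⊑G [] h = F⊑G _ h
shift-mono d (suc p) F⊑G (x ∷ A) h = shift-mono d p (λ B → F⊑G (x ∷ B)) A h
shift-mono d zero F⊑G (x ∷ []) h = F⊑G _ h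
shift-mono d zero F⊑G (false ∷ false ∷ A) h = F⊑G _ h
shift-mono d zero F⊑G (true ∷ true ∷ A) h = F⊑G _ h
shift-mono d zero F⊑G (true ∷ false ∷ A) h = op-mono d (F⊑G _) (F⊑G _) h
shift-mono d zero F⊑G (false ∷ true ∷ A) h = op-mono (not d) (F⊑G _) (F⊑G _) h

∂-op : ∀ d (F G : Family n) A → ∂ (λ B → op d (F B) (G B)) ∋ A → op d (∂ F A) (∂ G A) ≡ true
∂-op true F G A h = ∧-intro (∂-mono (λ B e → proj₁ (∧-elim e)) A h)
                            (∂-mono (λ B e → proj₂ (∧-elim {F B} e)) A h)
∂-op false F G (true ∷ A) h = ∂-op false (F ↾ true) (G ↾ true) A h
∂-op false F G (false ∷ A) h with ∂-elim (λ B → F B ∨ G B) A h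
... | inj₂ p = [ (λ q → ∨-introˡ (∂-here F A q)) , (λ q → ∨-introʳ {∂ F (false ∷ A)} (∂-here G A q)) ]′ (∨-elim p)
... | inj₁ p = [ (λ q → ∨-introˡ (∂-there F A q)) , (λ q → ∨-introʳ {∂ F (false ∷ A)} (∂-there G A q)) ]′
                 (∨-elim (∂-op false (F ↾ false) (G ↾ false) A p))

-- The shadow of a union or intersection of sections lies in the union or intersection of their
-- shadows. As shifting `∂ F` keeps its size, shifting `F` cannot enlarge the shadow.
∂-shift : ∀ d p (F : Family n) → ∂ (shift d p F) ⊑ shift d p (∂ F)
∂-shift d (suc p) F (true ∷ A) h = ∂-shift d p (F ↾ true) A h
∂-shift d (suc p) F (false ∷ A) h with ∨-elim h
... | inj₁ q = shift-mono d p (λ B → ∨-introˡ) A (∂-shift d p (F ↾ false) A q)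
... | inj₂ q = shift-mono d p (λ B → ∨-introʳ) A q
∂-shift d zero F (false ∷ []) h = h
∂-shift d zero F (false ∷ false ∷ A) h with ∂-elim (shift d zero F) (false ∷ A) h
... | inj₂ q = [ ∂-here F (false ∷ A) , (λ r → ∂-there F (false ∷ A) (∂-here (F ↾ false) A r)) ]′ (op-true d q)
... | inj₁ q with ∨-elim {∂ (F ↾ false ↾ false) A} q
...   | inj₁ r = ∂-there F (false ∷ A) (∂-there (F ↾ false) A r)
...   | inj₂ r = [ ∂-here F (false ∷ A) , (λ s → ∂-there F (false ∷ A) (∂-here (F ↾ false) A s)) ]′ (op-true (not d) r)
∂-shift d zero F (true ∷ true ∷ A) h = h
∂-shift d zero F (true ∷ false ∷ A) h with ∨-elim h
... | inj₁ q = op-mono d ∨-introˡ ∨-introˡ (∂-op d (F ↾ true ↾ false) (F ↾ false ↾ true) A q)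
-- The source set contains both positions, so removing either one puts both patterns into `∂ F`.
... | inj₂ q = op-intro d (∨-introʳ q) (∨-introʳ q)
∂-shift d zero F (false ∷ true ∷ A) h with ∨-elim h
... | inj₁ q = op-mono (not d) ∨-introˡ ∨-introˡ (∂-op (not d) (F ↾ true ↾ false) (F ↾ false ↾ true) A q)
... | inj₂ q = op-intro (not d) (∨-introʳ q) (∨-introʳ q)

size-∂-shift : ∀ d p (F : Family n) → size (∂ (shift d p F)) ≤ size (∂ F)
size-∂-shift d p F = ≤-trans (size-mono (∂-shift d p F)) (≤-reflexive (shift-size d p (∂ F)))

-- The side with the intersection offers both patterns, so one of them is complementary to whichever
-- pattern the other side has.
op-cross : ∀ d {a b a′ b′} → (a ≡ true → b′ ≡ true → ⊥) → (b ≡ true → a′ ≡ true → ⊥) →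
  op d a b ≡ true → op (not d) a′ b′ ≡ true → ⊥
op-cross true  f g h h′ with ∧-elim h
... | a , b = [ g b , f a ]′ (∨-elim h′)
op-cross false f g h h′ with ∧-elim h′
... | a′ , b′ = [ (λ a → f a b′) , (λ b → g b a′) ]′ (∨-elim h)

shift-cross : ∀ d p {F G : Family n} → Cross F G → Cross (shift d p F) (shift d p G)
shift-cross d p X [] [] = X [] []
shift-cross d (suc p) {F} {G} X (x ∷ A) (y ∷ B) FA GB D =
  shift-cross d p (λ A′ B′ FA′ GB′ D′ → X (x ∷ A′) (y ∷ B′) FA′ GB′ (disjoint-∷ (head x y D) D′))
    A B FA GB (λ i → D (suc i))
  where
  head : ∀ x y → Disjoint (x ∷ A) (y ∷ B) → x ∧ y ≡ false
  head false y D = refl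
  head true false D = refl
  head true true D = ⊥-elim (D zero refl refl)
shift-cross d zero X (x ∷ []) (y ∷ []) = X _ _
shift-cross d zero {F} {G} X (x ∷ y ∷ A) (x′ ∷ y′ ∷ B) FA GB D = go x y x′ y′ FA GB D
  where
  X′ : Disjoint A B → ∀ x y x′ y′ → x ∧ x′ ≡ false → y ∧ y′ ≡ false →
    F ∋ (x ∷ y ∷ A) → G ∋ (x′ ∷ y′ ∷ B) → ⊥
  X′ D x y x′ y′ p q f g = X _ _ f g (disjoint-∷ p (disjoint-∷ q D))

  go : ∀ x y x′ y′ → shift d zero F ∋ (x ∷ y ∷ A) → shift d zero G ∋ (x′ ∷ y′ ∷ B) →
    Disjoint (x ∷ y ∷ A) (x′ ∷ y′ ∷ B) → ⊥
  go true  _     true  _     f g D = D zero refl refl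
  go _     true  _     true  f g D = D (suc zero) refl refl
  go false false false false f g D = X′ (λ i → D (suc (suc i))) false false false false refl refl f g
  go false false true  true  f g D = X′ (λ i → D (suc (suc i))) false false true true refl refl f g
  go true  true  false false f g D = X′ (λ i → D (suc (suc i))) true true false false refl refl f g
  go false false true  false f g D = let Y = X′ (λ i → D (suc (suc i))) in
    [ Y false false true false refl refl f , Y false false false true refl refl f ]′ (op-true d g)
  go false false false true  f g D = let Y = X′ (λ i → D (suc (suc i))) in
    [ Y false false true false refl refl f , Y false false false true refl refl f ]′ (op-true (not d) g)
  go true  false false false f g D = let Y = X′ (λ i → D (suc (suc i))) in
    [ (λ f → Y true false false false refl refl f g) , (λ f → Y false true false false refl refl f g) ]′ (op-true d f)
  go false true  false false f g D = let Y = X′ (λ i → D (suc (suc i))) in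
    [ (λ f → Y true false false false refl refl f g) , (λ f → Y false true false false refl refl f g) ]′ (op-true (not d) f)
  go true  false false true  f g D = let Y = X′ (λ i → D (suc (suc i))) in
    op-cross d (Y true false false true refl refl) (Y false true true false refl refl) f g
  go false true  true  false f g D = let Y = X′ (λ i → D (suc (suc i))) in
    op-cross d (λ g f → Y false true true false refl refl f g) (λ g f → Y true false false true refl refl f g) g f

-- Shifted families and termination of shifting

Shifted : Bool → Family n → Set
Shifted {zero}        d F = ⊤
Shifted {suc zero}    d F = ⊤
Shifted {suc (suc n)} d F =
  (∀ A → F ∋ (d ∷ not d ∷ A) → F ∋ (not d ∷ d ∷ A)) × Shifted d (F ↾ false) × Shifted d (F ↾ true)

shifted-↾ : ∀ d x {F : Family (suc n)} → Shifted d F → Shifted d (F ↾ x)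
shifted-↾ {zero}  d x     S = tt
shifted-↾ {suc n} d false S = proj₁ (proj₂ S)
shifted-↾ {suc n} d true  S = proj₂ (proj₂ S)

-- The sum over A in F of the weights of the positions where A has entry d; the head weighs most,
-- so a shift that changes F lowers it.
potential : Bool → Family n → ℕ
potential {zero}  d F = 0
potential {suc n} d F = potential d (F ↾ false) + potential d (F ↾ true) + n * size (F ↾ d)

potential-∨-∧ : ∀ d (F G : Family n) →
  potential d (λ A → F A ∨ G A) + potential d (λ A → F A ∧ G A) ≡ potential d F + potential d G
potential-∨-∧ {zero} d F G = refl
potential-∨-∧ {suc n} d F G =
  trans (regroup n (potential d λ A → F (false ∷ A) ∨ G (false ∷ A)) (potential d λ A → F (true ∷ A) ∨ G (true ∷ A))
                   (size λ A → F (d ∷ A) ∨ G (d ∷ A))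
                   (potential d λ A → F (false ∷ A) ∧ G (false ∷ A)) (potential d λ A → F (true ∷ A) ∧ G (true ∷ A)) _)
  (trans (cong₂ _+_ (cong₂ _+_ (potential-∨-∧ d (F ↾ false) (G ↾ false)) (potential-∨-∧ d (F ↾ true) (G ↾ true)))
                    (cong (n *_) (size-∨-∧ (F ↾ d) (G ↾ d))))
         (sym (regroup n (potential d (F ↾ false)) (potential d (F ↾ true)) (size (F ↾ d))
                  (potential d (G ↾ false)) (potential d (G ↾ true)) _)))
  where
  regroup : ∀ n a b c a′ b′ c′ →
    (a + b + n * c) + (a′ + b′ + n * c′) ≡ (a + a′) + (b + b′) + n * (c + c′)
  regroup = solve-∀

⊑-antisym : {F G : Family n} → F ⊑ G → size G ≤ size F → G ⊑ F
⊑-antisym {zero} {F} {G} F⊑G le [] G[] with F [] | G []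
... | true  | true = refl
⊑-antisym {suc n} {F} {G} F⊑G le (false ∷ A) = ⊑-antisym (λ B → F⊑G (false ∷ B))
  (+-cancelʳ-≤ (size (F ↾ true)) _ _
    (≤-trans (+-monoʳ-≤ (size (G ↾ false)) (size-mono λ B → F⊑G (true ∷ B))) le)) A
⊑-antisym {suc n} {F} {G} F⊑G le (true ∷ A) = ⊑-antisym (λ B → F⊑G (true ∷ B))
  (+-cancelˡ-≤ (size (F ↾ false)) _ _
    (≤-trans (+-monoˡ-≤ (size (G ↾ true)) (size-mono λ B → F⊑G (false ∷ B))) le)) A

-- The tails occurring with both patterns; a shift at the first position leaves these in place.
Fixed : Family (suc (suc n)) → Family n
Fixed F A = F (true ∷ false ∷ A) ∧ F (false ∷ true ∷ A)

-- The first position weighs one more than the second, so every moved set lowers the potential by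
-- one, and the moved tails are those of the source pattern outside `Fixed F`.
potential-shift-zero : ∀ d (F : Family (suc (suc n))) →
  potential d (shift d zero F) + size (F ↾ d ↾ not d) ≡ potential d F + size (Fixed F)
potential-shift-zero {n} true F =
  identity n (potential true (F ↾ false ↾ false)) (potential true (F ↾ true ↾ true)) _ _
    (potential true (F ↾ true ↾ false)) (potential true (F ↾ false ↾ true))
    _ _ (size (F ↾ true ↾ false)) (size (F ↾ false ↾ true)) (size (F ↾ true ↾ true))
    (potential-∨-∧ true (F ↾ true ↾ false) (F ↾ false ↾ true)) (size-∨-∧ (F ↾ true ↾ false) (F ↾ false ↾ true))
  where
  shape : ∀ n p q pm a b c e →
    (p + a + n * c) + (b + q + n * e) + suc n * (pm + e) ≡ p + q + (a + b) + n * (c + pm) + pm + (n + suc n) * e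
  shape = solve-∀
  identity : ∀ n p q pj pm pa pb j m a b e → pj + pm ≡ pa + pb → j + m ≡ a + b →
    ((p + pj + n * j) + (pm + q + n * e) + suc n * (m + e)) + a
      ≡ ((p + pb + n * b) + (pa + q + n * e) + suc n * (a + e)) + m
  identity n p q pj pm pa pb j m a b e h k = begin
    ((p + pj + n * j) + (pm + q + n * e) + suc n * (m + e)) + a
      ≡⟨ cong (_+ a) (shape n p q m pj pm j e) ⟩
    p + q + (pj + pm) + n * (j + m) + m + (n + suc n) * e + a
      ≡⟨ cong₂ (λ s t → p + q + s + n * t + m + (n + suc n) * e + a) (trans h (+-comm pa pb)) (trans k (+-comm a b)) ⟩
    p + q + (pb + pa) + n * (b + a) + m + (n + suc n) * e + a
      ≡⟨ swap (p + q + (pb + pa) + n * (b + a)) m ((n + suc n) * e) a ⟩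
    p + q + (pb + pa) + n * (b + a) + a + (n + suc n) * e + m
      ≡⟨ cong (_+ m) (sym (shape n p q a pb pa b e)) ⟩
    ((p + pb + n * b) + (pa + q + n * e) + suc n * (a + e)) + m ∎
    where
    open ≡-Reasoning
    swap : ∀ s m x a → s + m + x + a ≡ s + a + x + m
    swap = solve-∀
potential-shift-zero {n} false F =
  identity n (potential false (F ↾ false ↾ false)) (potential false (F ↾ true ↾ true)) _ _
    (potential false (F ↾ true ↾ false)) (potential false (F ↾ false ↾ true))
    _ _ (size (F ↾ true ↾ false)) (size (F ↾ false ↾ true)) (size (F ↾ false ↾ false))
    (potential-∨-∧ false (F ↾ true ↾ false) (F ↾ false ↾ true)) (size-∨-∧ (F ↾ true ↾ false) (F ↾ false ↾ true))
  where
  shape : ∀ n p q pm a b c e →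
    (p + a + n * e) + (b + q + n * c) + suc n * (e + pm) ≡ p + q + (b + a) + n * (c + pm) + pm + (n + suc n) * e
  shape = solve-∀
  identity : ∀ n p q pj pm pa pb j m a b e → pj + pm ≡ pa + pb → j + m ≡ a + b →
    ((p + pm + n * e) + (pj + q + n * j) + suc n * (e + m)) + b
      ≡ ((p + pb + n * e) + (pa + q + n * a) + suc n * (e + b)) + m
  identity n p q pj pm pa pb j m a b e h k = begin
    ((p + pm + n * e) + (pj + q + n * j) + suc n * (e + m)) + b
      ≡⟨ cong (_+ b) (shape n p q m pm pj j e) ⟩
    p + q + (pj + pm) + n * (j + m) + m + (n + suc n) * e + b
      ≡⟨ cong₂ (λ s t → p + q + s + n * t + m + (n + suc n) * e + b) h k ⟩
    p + q + (pa + pb) + n * (a + b) + m + (n + suc n) * e + b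
      ≡⟨ swap (p + q + (pa + pb) + n * (a + b)) m ((n + suc n) * e) b ⟩
    p + q + (pa + pb) + n * (a + b) + b + (n + suc n) * e + m
      ≡⟨ cong (_+ m) (sym (shape n p q b pb pa a e)) ⟩
    ((p + pb + n * e) + (pa + q + n * a) + suc n * (e + b)) + m ∎
    where
    open ≡-Reasoning
    swap : ∀ s m x a → s + m + x + a ≡ s + a + x + m
    swap = solve-∀

Fixed⊑source : ∀ d (F : Family (suc (suc n))) → Fixed F ⊑ (F ↾ d ↾ not d)
Fixed⊑source true  F A h = proj₁ (∧-elim h)
Fixed⊑source false F A h = proj₂ (∧-elim {F (true ∷ false ∷ A)} h)

Fixed⊑target : ∀ d (F : Family (suc (suc n))) → Fixed F ⊑ (F ↾ not d ↾ d)
Fixed⊑target true  F A h = proj₂ (∧-elim {F (true ∷ false ∷ A)} h)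
Fixed⊑target false F A h = proj₁ (∧-elim h)

potential-shift-≤ : ∀ d p (F : Family n) → potential d (shift d p F) ≤ potential d F
potential-shift-≤ {zero} d p F = z≤n
potential-shift-≤ {suc n} d (suc p) F = +-mono-≤
  (+-mono-≤ (potential-shift-≤ d p (F ↾ false)) (potential-shift-≤ d p (F ↾ true)))
  (≤-reflexive (cong (n *_) (shift-size d p (F ↾ d))))
potential-shift-≤ {suc zero} d zero F = ≤-refl
potential-shift-≤ {suc (suc n)} d zero F = +-cancelʳ-≤ (size (F ↾ d ↾ not d)) _ _
  (≤-trans (≤-reflexive (potential-shift-zero d F)) (+-monoʳ-≤ (potential d F) (size-mono (Fixed⊑source d F))))

-- If `Fixed F` is as large as the source pattern, the two coincide and `F` is closed at the first
-- position; otherwise shifting there lowers the potential. Later positions are found in the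
-- sections.
shifted-or-decrease : ∀ d (F : Family n) → Shifted d F ⊎ ∃ λ p → potential d (shift d p F) < potential d F
shifted-or-decrease {zero} d F = inj₁ tt
shifted-or-decrease {suc zero} d F = inj₁ tt
shifted-or-decrease {suc (suc n)} d F
  with size (F ↾ d ↾ not d) ≤? size (Fixed F) | shifted-or-decrease d (F ↾ false) | shifted-or-decrease d (F ↾ true)
... | no l≰ | _ | _ = inj₂ (zero , +-cancelʳ-< (size (F ↾ d ↾ not d)) _ _
        (≤-<-trans (≤-reflexive (potential-shift-zero d F)) (+-monoʳ-< (potential d F) (≰⇒> l≰))))
... | yes l≤ | inj₁ S₀ | inj₁ S₁ =
        inj₁ ((λ A h → Fixed⊑target d F A (⊑-antisym (Fixed⊑source d F) l≤ A h)) , S₀ , S₁)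
... | yes _ | inj₂ (p , lt) | _ = inj₂ (suc p , +-mono-<-≤
          (+-mono-<-≤ lt (potential-shift-≤ d p (F ↾ true)))
          (≤-reflexive (cong (suc n *_) (shift-size d p (F ↾ d)))))
... | yes _ | inj₁ _ | inj₂ (p , lt) = inj₂ (suc p , +-mono-<-≤
          (+-mono-≤-< (potential-shift-≤ d p (F ↾ false)) lt)
          (≤-reflexive (cong (suc n *_) (shift-size d p (F ↾ d)))))

shifts : Bool → List ℕ → Family n → Family n
shifts d []       F = F
shifts d (p ∷ ps) F = shifts d ps (shift d p F)

module _ (d : Bool) where

  shifts-size : ∀ ps (F : Family n) → size (shifts d ps F) ≡ size F
  shifts-size []       F = refl
  shifts-size (p ∷ ps) F = trans (shifts-size ps (shift d p F)) (shift-size d p F)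

  shifts-∂ : ∀ ps (F : Family n) → size (∂ (shifts d ps F)) ≤ size (∂ F)
  shifts-∂ []       F = ≤-refl
  shifts-∂ (p ∷ ps) F = ≤-trans (shifts-∂ ps (shift d p F)) (size-∂-shift d p F)

  shifts-uniform : ∀ ps {k} {F : Family n} → Uniform k F → Uniform k (shifts d ps F)
  shifts-uniform []       U = U
  shifts-uniform (p ∷ ps) U = shifts-uniform ps (shift-uniform d p U)

  shifts-cross : ∀ ps {F G : Family n} → Cross F G → Cross (shifts d ps F) (shifts d ps G)
  shifts-cross []       X = X
  shifts-cross (p ∷ ps) X = shifts-cross ps (shift-cross d p X)

  -- One list must serve both families, because `shift-cross` applies the same shift to both. The
  -- sum of the potentials is the termination measure.
  shifts-exhaust : (F G : Family n) → ∃ λ ps → Shifted d (shifts d ps F) × Shifted d (shifts d ps G)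
  shifts-exhaust F G = go F G (<-wellFounded _)
    where
    go : (F G : Family n) → Acc _<_ (potential d F + potential d G) →
      ∃ λ ps → Shifted d (shifts d ps F) × Shifted d (shifts d ps G)
    go F G (acc rs) with shifted-or-decrease d F | shifted-or-decrease d G
    ... | inj₁ S | inj₁ T = [] , S , T
    ... | inj₂ (p , lt) | _ = let ps , ST = go _ _ (rs (+-mono-<-≤ lt (potential-shift-≤ d p G))) in p ∷ ps , ST
    ... | inj₁ _ | inj₂ (p , lt) = let ps , ST = go _ _ (rs (+-mono-≤-< (potential-shift-≤ d p F) lt)) in p ∷ ps , ST

-- Binomial coefficients and Kruskal–Katona

-- L d r is the binomial coefficient (d + r choose d).
L : ℕ → ℕ → ℕ
L zero    r       = 1
L (suc d) zero    = 1
L (suc d) (suc r) = L d (suc r) + L (suc d) r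

0<L : ∀ d r → 0 < L d r
0<L zero    r       = z<s
0<L (suc d) zero    = z<s
0<L (suc d) (suc r) = <-≤-trans (0<L d (suc r)) (m≤m+n _ _)

L-zeroʳ : ∀ d → L d 0 ≡ 1
L-zeroʳ zero    = refl
L-zeroʳ (suc d) = refl

L-1ʳ : ∀ d → L d 1 ≡ suc d
L-1ʳ zero    = refl
L-1ʳ (suc d) = trans (+-comm (L d 1) 1) (cong suc (L-1ʳ d))

L-1ˡ : ∀ r → L 1 r ≡ suc r
L-1ˡ zero    = refl
L-1ˡ (suc r) = cong suc (L-1ˡ r)

-- Absorption: both sides are (d + 1 + r)! / (d! r!).
L-absorb : ∀ d r → suc d * L (suc d) r ≡ suc r * L d (suc r)
L-absorb zero r = trans (+-identityʳ _) (trans (L-1ˡ r) (sym (*-identityʳ (suc r))))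
L-absorb (suc d) zero = trans (*-identityʳ _) (trans (sym (L-1ʳ (suc d))) (sym (+-identityʳ _)))
L-absorb (suc d) (suc r) = begin
  suc (suc d) * (X + L (suc (suc d)) r)                 ≡⟨ *-distribˡ-+ (suc (suc d)) X _ ⟩
  suc (suc d) * X + suc (suc d) * L (suc (suc d)) r     ≡⟨ cong (suc (suc d) * X +_) (L-absorb (suc d) r) ⟩
  suc (suc d) * X + suc r * X                           ≡⟨ rearrange d r X ⟩
  suc d * X + suc (suc r) * X                           ≡⟨ cong (_+ suc (suc r) * X) (L-absorb d (suc r)) ⟩
  suc (suc r) * L d (suc (suc r)) + suc (suc r) * X     ≡⟨ *-distribˡ-+ (suc (suc r)) (L d (suc (suc r))) X ⟨
  suc (suc r) * (L d (suc (suc r)) + X)                 ∎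
  where
  open ≡-Reasoning
  X = L (suc d) (suc r)
  rearrange : ∀ d r x → suc (suc d) * x + suc r * x ≡ suc d * x + suc (suc r) * x
  rearrange = solve-∀

uniform>n⇒size≡0 : ∀ {k} {F : Family n} → Uniform k F → n < k → size F ≡ 0
uniform>n⇒size≡0 {F = F} U n<k = empty⇒size≡0 F λ A FA →
  <⇒≱ n<k (subst (_≤ _) (U A FA) (∣p∣≤n A))

uniform-0-size-↾true : {F : Family (suc n)} → Uniform 0 F → size (F ↾ true) ≡ 0
uniform-0-size-↾true {F = F} U = empty⇒size≡0 (F ↾ true) (uniform-0-↾true {F = F} U)

size≤L : ∀ d r {F : Family n} → Uniform d F → n ≤ d + r → size F ≤ L d r
size≤L {zero} d r {F} U le with F []
... | false = z≤n
... | true  = 0<L d r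
size≤L {suc n} zero r {F} U le = begin
  size (F ↾ false) + size (F ↾ true) ≡⟨ cong (size (F ↾ false) +_) (uniform-0-size-↾true U) ⟩
  size (F ↾ false) + 0               ≡⟨ +-identityʳ _ ⟩
  size (F ↾ false)                   ≤⟨ size≤L 0 r (uniform-↾false U) (≤-trans (n≤1+n n) le) ⟩
  1                                  ∎
  where open ≤-Reasoning
size≤L {suc n} (suc d) zero {F} U (s≤s le) = +-mono-≤
  (≤-reflexive (uniform>n⇒size≡0 (uniform-↾false U) (s≤s (subst (n ≤_) (+-identityʳ d) le))))
  (subst (size (F ↾ true) ≤_) (L-zeroʳ d) (size≤L d 0 (uniform-↾true U) le))
size≤L {suc n} (suc d) (suc r) {F} U (s≤s le) = begin
  size (F ↾ false) + size (F ↾ true) ≤⟨ +-mono-≤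
      (size≤L (suc d) r (uniform-↾false U) (subst (n ≤_) (+-suc d r) le))
      (size≤L d (suc r) (uniform-↾true U) le) ⟩
  L (suc d) r + L d (suc r)          ≡⟨ +-comm (L (suc d) r) _ ⟩
  L (suc d) (suc r)                  ∎
  where open ≤-Reasoning

∂-inhabited : ∀ {k} (F : Family n) A → F ∋ A → ∣ A ∣ ≡ suc k → ∃ λ B → ∂ F ∋ B
∂-inhabited F (true ∷ A) FA e = false ∷ A , ∂-here F A FA
∂-inhabited F (false ∷ A) FA e =
  let B , h = ∂-inhabited (F ↾ false) A FA e in false ∷ B , ∂-there F B h

0<size-∂ : ∀ {k} {F : Family n} → Uniform (suc k) F → 0 < size F → 0 < size (∂ F)
0<size-∂ {F = F} U 0<F =
  let A , FA = 0<size⇒∃ F 0<F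
      B , h  = ∂-inhabited F A FA (U A FA)
  in ∃⇒0<size (∂ F) B h

∂-↾-≤ : (F : Family (suc n)) → size (F ↾ true) + size (∂ (F ↾ true)) ≤ size (∂ F)
∂-↾-≤ F = +-monoˡ-≤ (size (∂ (F ↾ true))) (size-mono (∂-here F))

-- Instead of being removed, the point can be moved step by step to the head.
shifted-∂↾false⊑↾true : (F : Family (suc n)) → Shifted false F → ∂ (F ↾ false) ⊑ (F ↾ true)
shifted-∂↾false⊑↾true F S (false ∷ A) h with ∂-elim (F ↾ false) A h
... | inj₂ q = proj₁ S A q
... | inj₁ q = proj₁ S A (shifted-∂↾false⊑↾true (F ↾ false) (shifted-↾ false false {F} S) A q)
shifted-∂↾false⊑↾true F S (true ∷ A) h =
  shifted-∂↾false⊑↾true (F ↾ true) (shifted-↾ false true {F} S) A (∂-mono (proj₁ S) A h)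

-- Here the head is the smallest point, so the shift is towards the head.
module _ {d : ℕ} (P : ℕ → ℕ → Set)
  (step : (F : Family (suc n)) → Uniform d F → ∂ (F ↾ false) ⊑ (F ↾ true) → P (size F) (size (∂ F)))
  (mono : ∀ {s t t′} → t ≤ t′ → P s t → P s t′) where

  by-shifting : (F : Family (suc n)) → Uniform d F → P (size F) (size (∂ F))
  by-shifting F U =
    let ps , S , _ = shifts-exhaust false F F
        G = shifts false ps F
    in mono (shifts-∂ false ps F)
         (subst (λ s → P s (size (∂ G))) (shifts-size false ps F)
           (step G (shifts-uniform false ps U) (shifted-∂↾false⊑↾true G S)))

-- Kruskal-Katona at the binomial sizes C(e+1+r, e+1). After shifting, `F ↾ true` has at least
-- C(e+r, e) members; these and their shadow are two disjoint parts of `∂ F`, and Pascal's rule adds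
-- up the bounds.
L≤⇒L≤∂ : ∀ e r {F : Family n} → Uniform (suc e) F → 0 < size F →
  L (suc e) r ≤ size F → L e (suc r) ≤ size (∂ F)
L≤⇒L≤∂ {zero} e r {F} U 0<F _ = contradiction (uniform>n⇒size≡0 U z<s) (>⇒≢ 0<F)
L≤⇒L≤∂ {suc n} e r {F} U = by-shifting
  (λ s t → 0 < s → L (suc e) r ≤ s → L e (suc r) ≤ t)
  step (λ t≤t′ P 0<s L≤s → ≤-trans (P 0<s L≤s) t≤t′) F U
  where
  step : (F : Family (suc n)) → Uniform (suc e) F → ∂ (F ↾ false) ⊑ (F ↾ true) →
    0 < size F → L (suc e) r ≤ size F → L e (suc r) ≤ size (∂ F)
  step F U nested 0<F L≤F = ≤-trans (conclude e (uniform-↾true U) (L≤u r L≤F)) (∂-↾-≤ F)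
    where
    u w : ℕ
    u = size (F ↾ true)
    w = size (F ↾ false)
    ∂w≤u : size (∂ (F ↾ false)) ≤ u
    ∂w≤u = size-mono nested
    0<u : 0 < u
    0<u with 0 <? u
    ... | yes p = p
    ... | no ¬p = contradiction (≤-trans (0<size-∂ (uniform-↾false U) 0<w) ∂w≤u) ¬p
      where
      0<w : 0 < w
      0<w = subst (0 <_) (trans (cong (w +_) (n≤0⇒n≡0 (≮⇒≥ ¬p))) (+-identityʳ w)) 0<F
    L≤u : ∀ r → L (suc e) r ≤ w + u → L e r ≤ u
    L≤u zero L≤ = subst (_≤ u) (sym (L-zeroʳ e)) 0<u
    -- If `u` is too small, Pascal's rule makes `w` large, and by induction so is its shadow, which
    -- lies inside `F ↾ true`.
    L≤u (suc r) L≤ with L e (suc r) ≤? u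
    ... | yes p = p
    ... | no ¬p = contradiction
            (≤-trans (L≤⇒L≤∂ e r (uniform-↾false U) (≤-<-trans z≤n L<w) (<⇒≤ L<w)) ∂w≤u) ¬p
      where
      L<w : L (suc e) r < w
      L<w = +-cancelʳ-< u _ _ (<-≤-trans
        (subst (L (suc e) r + u <_) (+-comm (L (suc e) r) _) (+-monoʳ-< (L (suc e) r) (≰⇒> ¬p))) L≤)
    conclude : ∀ e → Uniform e (F ↾ true) → L e r ≤ u → L e (suc r) ≤ u + size (∂ (F ↾ true))
    conclude zero    U₁ L≤ = ≤-trans 0<u (m≤m+n _ _)
    conclude (suc e) U₁ L≤ = subst (_≤ u + size (∂ (F ↾ true))) (+-comm (L (suc e) r) _)
      (+-mono-≤ L≤ (L≤⇒L≤∂ e r U₁ 0<u L≤))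

-- The ratio d / (r + 1) is attained by all d-subsets of a (d + r)-set; smaller families expand at
-- least as much.
kruskal-katona : ∀ d r {F : Family n} → Uniform d F → size F ≤ L d r →
  d * size F ≤ suc r * size (∂ F)
kruskal-katona zero r U _ = z≤n
kruskal-katona {zero} (suc e) r {F} U _ rewrite uniform>n⇒size≡0 U (z<s {e}) | *-zeroʳ e = z≤n
kruskal-katona {suc n} (suc e) r {F} U = by-shifting
  (λ s t → s ≤ L (suc e) r → suc e * s ≤ suc r * t)
  step (λ t≤t′ P s≤L → ≤-trans (P s≤L) (*-monoʳ-≤ (suc r) t≤t′)) F U
  where
  step : (F : Family (suc n)) → Uniform (suc e) F → ∂ (F ↾ false) ⊑ (F ↾ true) →
    size F ≤ L (suc e) r → suc e * size F ≤ suc r * size (∂ F)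
  step F U nested F≤L with size (F ↾ true) ≤? L e r
  ... | yes u≤L = begin
    suc e * (w + u)              ≡⟨ expand e w u ⟩
    suc e * w + (u + e * u)      ≤⟨ +-mono-≤ (w-bound r F≤L) (+-monoʳ-≤ u (kruskal-katona e r (uniform-↾true U) u≤L)) ⟩
    r * u + (u + suc r * t)      ≡⟨ collect r u t ⟩
    suc r * (u + t)              ≤⟨ *-monoʳ-≤ (suc r) (∂-↾-≤ F) ⟩
    suc r * size (∂ F)           ∎
    where
    open ≤-Reasoning
    u w t : ℕ
    u = size (F ↾ true)
    w = size (F ↾ false)
    t = size (∂ (F ↾ true))
    ∂w≤u : size (∂ (F ↾ false)) ≤ u
    ∂w≤u = size-mono nested
    expand : ∀ e w u → suc e * (w + u) ≡ suc e * w + (u + e * u)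
    expand = solve-∀
    collect : ∀ r u t → r * u + (u + suc r * t) ≡ suc r * (u + t)
    collect = solve-∀
    -- The shadow of the section without the head has size at most `u`, so induction with `r` one
    -- smaller applies; a section too large for that would push `w + u` past the total.
    w-bound : ∀ r → w + u ≤ L (suc e) r → suc e * w ≤ r * u
    w-bound zero w+u≤1 with 0 <? w
    ... | no ¬p rewrite n≤0⇒n≡0 (≮⇒≥ ¬p) | *-zeroʳ e = z≤n
    ... | yes 0<w = contradiction w+u≤1
            (<⇒≱ (+-mono-≤ 0<w (≤-trans (0<size-∂ (uniform-↾false U) 0<w) ∂w≤u)))
    w-bound (suc r) w+u≤L with w ≤? L (suc e) r
    ... | yes w≤L = ≤-trans (kruskal-katona (suc e) r (uniform-↾false U) w≤L) (*-monoʳ-≤ (suc r) ∂w≤u)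
    ... | no w≰L = contradiction w+u≤L (<⇒≱ (subst (_< w + u) (+-comm (L (suc e) r) _)
            (+-mono-<-≤ (≰⇒> w≰L) (≤-trans
              (L≤⇒L≤∂ e r (uniform-↾false U) (≤-<-trans z≤n (≰⇒> w≰L)) (<⇒≤ (≰⇒> w≰L))) ∂w≤u))))
  -- Here `∂ F` already has at least C(e+1+r, e) members, and absorption compares this with the
  -- largest allowed size of `F`.
  ... | no u≰L = begin
    suc e * size F               ≤⟨ *-monoʳ-≤ (suc e) F≤L ⟩
    suc e * L (suc e) r          ≡⟨ L-absorb e r ⟩
    suc r * L e (suc r)          ≤⟨ *-monoʳ-≤ (suc r) (conclude e (uniform-↾true U) (<⇒≤ (≰⇒> u≰L))) ⟩
    suc r * (u + size (∂ (F ↾ true)))  ≤⟨ *-monoʳ-≤ (suc r) (∂-↾-≤ F) ⟩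
    suc r * size (∂ F)           ∎
    where
    open ≤-Reasoning
    u : ℕ
    u = size (F ↾ true)
    0<u : 0 < u
    0<u = ≤-<-trans z≤n (≰⇒> u≰L)
    conclude : ∀ e → Uniform e (F ↾ true) → L e r ≤ u → L e (suc r) ≤ u + size (∂ (F ↾ true))
    conclude zero    U₁ L≤ = ≤-trans 0<u (m≤m+n _ _)
    conclude (suc e) U₁ L≤ = subst (_≤ u + size (∂ (F ↾ true))) (+-comm (L (suc e) r) _)
      (+-mono-≤ L≤ (L≤⇒L≤∂ e r U₁ 0<u L≤))

lym : ∀ {a r} {F : Family n} → Uniform a F → n ≤ a + r → a * size F ≤ suc r * size (∂ F)
lym {a = a} {r} U le = kruskal-katona a r U (size≤L a r U le)

-- For positive d, a family of at most C(2d-1, d) sets has shadow ratio at least d / d, so a bad one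
-- exceeds this number, which is half of C(2d, d).
bad⇒L≤2*size : ∀ d {F : Family n} → Uniform d F → Bad F → L d d ≤ 2 * size F
bad⇒L≤2*size zero U bad = ≤-trans (≤-<-trans z≤n bad) (m≤m+n _ _)
bad⇒L≤2*size (suc e) {F} U bad with size F ≤? L (suc e) e
... | yes F≤L = contradiction (*-cancelˡ-≤ (suc e) (kruskal-katona (suc e) e U F≤L)) (<⇒≱ bad)
... | no F≰L = begin
  L e (suc e) + L (suc e) e       ≡⟨ cong (_+ L (suc e) e) (*-cancelˡ-≡ _ _ (suc e) (L-absorb e e)) ⟨
  L (suc e) e + L (suc e) e       ≤⟨ +-mono-≤ L≤F (≤-trans L≤F (m≤m+n _ 0)) ⟩
  2 * size F                      ∎
  where
  open ≤-Reasoning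
  L≤F : L (suc e) e ≤ size F
  L≤F = <⇒≤ (≰⇒> F≰L)

-- Expansion of families that cross-intersect a bad family

-- Exactly the failure of the threshold in `whole-expands`. For `α = β = 1` it says that at most
-- half of the points are used.
Thin : ℕ → ℕ → Subset n → Set
Thin {n} α β A = (α + β) * ∣ A ∣ < α * suc n

-- Tails of the vector play the role of the initial segments: the head is the largest point.
Sparse : ℕ → ℕ → Subset n → Set
Sparse α β []      = Thin α β []
Sparse α β (x ∷ A) = Thin α β (x ∷ A) × Sparse α β A

∂-↾-≤₂ : (F : Family (suc n)) → size (∂ (F ↾ false)) + size (∂ (F ↾ true)) ≤ size (∂ F)
∂-↾-≤₂ F = +-monoˡ-≤ (size (∂ (F ↾ true))) (size-mono (∂-there F))

-- The threshold rearranges to α (n - a + 1) ≤ β a, which converts the ratio of the local LYM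
-- inequality into α : β.
whole-expands : ∀ α β a {F : Family n} → Uniform a F → α * suc n ≤ (α + β) * a →
  α * size F ≤ β * size (∂ F)
whole-expands {n} α β a {F} U le with n <? a
... | yes n<a rewrite uniform>n⇒size≡0 U n<a | *-zeroʳ α = z≤n
whole-expands zero β zero U le | no _ = z≤n
whole-expands (suc α) β zero U le | no _ rewrite *-zeroʳ (α + β) = contradiction le λ ()
whole-expands {n} α β a@(suc _) {F} U le | no n≮a = *-cancelˡ-≤ a (begin
  a * (α * s)          ≡⟨ swap a α s ⟩
  α * (a * s)          ≤⟨ *-monoʳ-≤ α (lym U (≤-reflexive (sym n≡a+r))) ⟩
  α * (suc r * t)      ≡⟨ *-assoc α (suc r) t ⟨
  α * suc r * t        ≤⟨ *-monoˡ-≤ t (+-cancelˡ-≤ (α * a) _ _ αr≤) ⟩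
  β * a * t            ≡⟨ swap′ β a t ⟩
  a * (β * t)          ∎)
  where
  open ≤-Reasoning
  r s t : ℕ
  r = n ∸ a
  s = size F
  t = size (∂ F)
  n≡a+r : a + r ≡ n
  n≡a+r = m+[n∸m]≡n (≮⇒≥ n≮a)
  αr≤ : α * a + α * suc r ≤ α * a + β * a
  αr≤ = begin
    α * a + α * suc r  ≡⟨ *-distribˡ-+ α a (suc r) ⟨
    α * (a + suc r)    ≡⟨ cong (α *_) (trans (+-suc a r) (cong suc n≡a+r)) ⟩
    α * suc n          ≤⟨ le ⟩
    (α + β) * a        ≡⟨ *-distribʳ-+ a α β ⟩
    α * a + β * a      ∎
  swap : ∀ a b c → a * (b * c) ≡ b * (a * c)
  swap = solve-∀
  swap′ : ∀ a b c → a * b * c ≡ b * (a * c)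
  swap′ = solve-∀

-- Below the threshold every member is thin at full length, so a sparse tail in a section extends to
-- a sparse member. If neither section has one, both expand, and their shadows occupy disjoint parts
-- of `∂ F`.
expands-or-sparse : ∀ α β a {F : Family n} → Uniform a F →
  α * size F ≤ β * size (∂ F) ⊎ ∃ λ A → F ∋ A × Sparse α β A
expands-or-sparse {n} α β a {F} U with α * suc n ≤? (α + β) * a
... | yes le = inj₁ (whole-expands α β a U le)
expands-or-sparse {zero} α β a {F} U | no ≰ with 0 <? size F
... | no ¬p rewrite n≤0⇒n≡0 (≮⇒≥ ¬p) | *-zeroʳ α = inj₁ z≤n
... | yes p with 0<size⇒∃ F p
...   | [] , F[] = inj₂ ([] , F[] , subst (λ m → (α + β) * m < α * 1) (sym (U [] F[])) (≰⇒> ≰))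
expands-or-sparse {suc n} α β a {F} U | no ≰ = combine (expands-or-sparse α β a (uniform-↾false U)) (true-part a U)
  where
  true-part : ∀ a → Uniform a F →
    α * size (F ↾ true) ≤ β * size (∂ (F ↾ true)) ⊎ ∃ λ A → F ∋ (true ∷ A) × Sparse α β A
  true-part zero U rewrite uniform-0-size-↾true U | *-zeroʳ α = inj₁ z≤n
  true-part (suc a) U = expands-or-sparse α β a (uniform-↾true U)
  thin : ∀ A → F ∋ A → Thin α β A
  thin A FA = subst (λ m → (α + β) * m < α * suc (suc n)) (sym (U A FA)) (≰⇒> ≰)
  combine :
    α * size (F ↾ false) ≤ β * size (∂ (F ↾ false)) ⊎ (∃ λ A → F ∋ (false ∷ A) × Sparse α β A) →
    α * size (F ↾ true) ≤ β * size (∂ (F ↾ true)) ⊎ (∃ λ A → F ∋ (true ∷ A) × Sparse α β A) →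
    α * size F ≤ β * size (∂ F) ⊎ ∃ λ A → F ∋ A × Sparse α β A
  combine (inj₁ p) (inj₁ q) = inj₁ (begin
    α * (size (F ↾ false) + size (F ↾ true))              ≡⟨ *-distribˡ-+ α (size (F ↾ false)) _ ⟩
    α * size (F ↾ false) + α * size (F ↾ true)            ≤⟨ +-mono-≤ p q ⟩
    β * size (∂ (F ↾ false)) + β * size (∂ (F ↾ true))    ≡⟨ *-distribˡ-+ β (size (∂ (F ↾ false))) _ ⟨
    β * (size (∂ (F ↾ false)) + size (∂ (F ↾ true)))      ≤⟨ *-monoʳ-≤ β (∂-↾-≤₂ F) ⟩
    β * size (∂ F)                                        ∎)
    where open ≤-Reasoning
  combine (inj₂ (A , FA , sp)) _ = inj₂ (false ∷ A , FA , thin (false ∷ A) FA , sp)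
  combine (inj₁ _) (inj₂ (A , FA , sp)) = inj₂ (true ∷ A , FA , thin (true ∷ A) FA , sp)

-- Every tail has room for disjoint copies of both sets' tails; this lets one set be moved off the
-- other.
Fits : Subset n → Subset n → Set
Fits [] [] = ⊤
Fits {suc n} (x ∷ A) (y ∷ B) = ∣ x ∷ A ∣ + ∣ y ∷ B ∣ ≤ suc n × Fits A B

-- Receives a point from the head in the first gap; a full vector is returned unchanged.
fill : Subset n → Subset n
fill []          = []
fill (false ∷ A) = true ∷ A
fill (true ∷ A)  = true ∷ fill A

∣fill∣≤ : (A : Subset n) → ∣ fill A ∣ ≤ suc ∣ A ∣
∣fill∣≤ []          = z≤n
∣fill∣≤ (false ∷ A) = ≤-refl
∣fill∣≤ (true ∷ A)  = s≤s (∣fill∣≤ A)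

shifted-slide : (F : Family (suc n)) → Shifted true F → ∀ A → ∣ A ∣ < n →
  F ∋ (true ∷ A) → F ∋ (false ∷ fill A)
shifted-slide F S (false ∷ A) lt h = proj₁ S A h
shifted-slide F S (true ∷ A) (s≤s lt) h =
  proj₁ S (fill A) (shifted-slide (F ↾ true) (shifted-↾ true true {F} S) A lt h)

∣∷∣≤ : ∀ y (B : Subset n) → ∣ B ∣ ≤ ∣ y ∷ B ∣
∣∷∣≤ true  B = n≤1+n _
∣∷∣≤ false B = ≤-refl

-- All entries before the gap are points of `A`, so the spare room of the whole vector persists down
-- to the gap; past it nothing changes.
fits-fill : (A B : Subset n) → Fits A B → suc (∣ A ∣ + ∣ B ∣) ≤ n → Fits (fill A) B
fits-fill [] [] _ ()
fits-fill (false ∷ A) (y ∷ B) (_ , fit) le = le , fit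
fits-fill (true ∷ A) (y ∷ B) (_ , fit) (s≤s le) =
  ≤-trans (s≤s (+-monoˡ-≤ ∣ y ∷ B ∣ (∣fill∣≤ A))) (s≤s le) ,
  fits-fill A B fit (≤-trans (s≤s (+-monoʳ-≤ ∣ A ∣ (∣∷∣≤ y B))) le)

-- Scan from the head: a point of `B` that meets `A` slides to the next gap of `B`, where it is
-- examined again in its turn.
shifted-avoids : (H : Family n) → Shifted true H → ∀ B A → H ∋ B → Fits B A →
  ∃ λ B′ → H ∋ B′ × Disjoint A B′
shifted-avoids H S [] [] h _ = [] , h , disjoint-[]
shifted-avoids H S (x ∷ B) (false ∷ A) h (_ , fit) =
  let B′ , h′ , D = shifted-avoids (H ↾ x) (shifted-↾ true x {H} S) B A h fit
  in x ∷ B′ , h′ , disjoint-∷ refl D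
shifted-avoids H S (false ∷ B) (true ∷ A) h (_ , fit) =
  let B′ , h′ , D = shifted-avoids (H ↾ false) (shifted-↾ true false {H} S) B A h fit
  in false ∷ B′ , h′ , disjoint-∷ refl D
shifted-avoids {suc n} H S (true ∷ B) (true ∷ A) h (s≤s le , fit) =
  let le′ = subst (_≤ n) (+-suc ∣ B ∣ ∣ A ∣) le
      B′ , h′ , D = shifted-avoids (H ↾ false) (shifted-↾ true false {H} S) (fill B) A
        (shifted-slide H S B (≤-trans (s≤s (m≤m+n _ _)) le′) h) (fits-fill B A fit le′)
  in false ∷ B′ , h′ , disjoint-∷ refl D

-- The source of the weights `suc b` and `b`: from 2x ≤ t and x ≤ b follows (2b+1) x ≤ b (t+1), the
-- exact complement of the bound on y.
thin⇒fits : ∀ {b t x y} → (1 + 1) * x < 1 * suc t → (suc b + b) * y < suc b * suc t → x ≤ b → x + y ≤ t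
thin⇒fits {b} {t} {x} {y} 2x<t y-thin x≤b with x + y ≤? t
... | yes p = p
... | no p = contradiction (begin-strict
  (suc b + b) * suc t                       ≤⟨ *-monoʳ-≤ (suc b + b) (≰⇒> p) ⟩
  (suc b + b) * (x + y)                     ≡⟨ *-distribˡ-+ (suc b + b) x y ⟩
  (suc b + b) * x + (suc b + b) * y         <⟨ +-monoʳ-< ((suc b + b) * x) y-thin ⟩
  (suc b + b) * x + suc b * suc t           ≡⟨ cong (_+ suc b * suc t) (split b x) ⟩
  b * (2 * x) + x + suc b * suc t           ≤⟨ +-monoˡ-≤ (suc b * suc t) (+-mono-≤ (*-monoʳ-≤ b 2x≤t) x≤b) ⟩
  b * t + b + suc b * suc t                 ≡⟨ join b t ⟩
  (suc b + b) * suc t                       ∎) (<-irrefl refl)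
  where
  open ≤-Reasoning
  2x≤t : 2 * x ≤ t
  2x≤t = ≤-pred (subst (2 * x <_) (*-identityˡ (suc t)) 2x<t)
  split : ∀ b x → (suc b + b) * x ≡ b * (2 * x) + x
  split = solve-∀
  join : ∀ b t → b * t + b + suc b * suc t ≡ (suc b + b) * suc t
  join = solve-∀

sparse⇒fits : ∀ {b} (B A : Subset n) → Sparse 1 1 B → Sparse (suc b) b A → ∣ B ∣ ≤ b → Fits B A
sparse⇒fits [] [] _ _ _ = tt
sparse⇒fits {b = b} (x ∷ B) (y ∷ A) (p , P) (q , Q) le =
  thin⇒fits {b} p q le , sparse⇒fits B A P Q (≤-trans (∣∷∣≤ x B) le)

module _ {b} {K H : Family n} (UH : Uniform b H) (X : Cross K H) (bad : Bad H) where

  private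
    ps : _
    ps = proj₁ (shifts-exhaust true K H)
    K′ H′ : Family n
    K′ = shifts true ps K
    H′ = shifts true ps H

  -- The shifted `H` is still bad, so it contains a set using at most half of every tail. A sparse
  -- member of `K′` would fit with that set and hence miss some member of `H′`.
  cross-shifted : ∃ λ K′ → (size K′ ≡ size K) × (size (∂ K′) ≤ size (∂ K)) ×
    (∀ {a} → Uniform a K → Uniform a K′) × (∀ A → K′ ∋ A → ¬ Sparse (suc b) b A)
  cross-shifted = K′ , shifts-size true ps K , shifts-∂ true ps K , shifts-uniform true ps , not-sparse
    where
    UH′ : Uniform b H′
    UH′ = shifts-uniform true ps UH
    not-sparse : ∀ A → K′ ∋ A → ¬ Sparse (suc b) b A
    not-sparse A KA spA with expands-or-sparse 1 1 b {H′} UH′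
    ... | inj₁ le = contradiction (≤-trans (subst₂ _≤_ (*-identityˡ _) (*-identityˡ _) le) (shifts-∂ true ps H))
            (<⇒≱ (subst (size (∂ H) <_) (sym (shifts-size true ps H)) bad))
    ... | inj₂ (B , HB , spB) =
      let B′ , HB′ , D = shifted-avoids H′ (proj₂ (proj₂ (shifts-exhaust true K H))) B A HB
            (sparse⇒fits B A spB spA (≤-reflexive (UH′ B HB)))
      in shifts-cross true ps X A B′ KA HB′ D

  cross-expands : ∀ {a} → Uniform a K → suc b * size K ≤ b * size (∂ K)
  cross-expands {a} UK with cross-shifted
  ... | K′ , eq , le , U , ns with expands-or-sparse (suc b) b a (U UK)
  ...   | inj₁ p = subst (λ s → suc b * s ≤ b * size (∂ K)) eq (≤-trans p (*-monoʳ-≤ b le))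
  ...   | inj₂ (A , KA , sp) = contradiction sp (ns A KA)

-- A sharper expansion inequality

thin-lower : ∀ {i t u} → u ≤ suc i → (suc i + i) * u < suc i * t → (suc (suc i) + suc i) * u < suc (suc i) * t
thin-lower {i} {t} {u} u≤ thin with (suc (suc i) + suc i) * u <? suc (suc i) * t
... | yes p = p
... | no ≮ = contradiction (begin
  suc i * t + u                ≤⟨ +-monoʳ-≤ (suc i * t) u≤ ⟩
  suc i * t + suc i            ≡⟨ trans (+-comm _ (suc i)) (sym (*-suc (suc i) t)) ⟩
  suc i * suc t                ≤⟨ *-monoʳ-≤ (suc i) t<2u ⟩
  suc i * (2 * u)              ≡⟨ split i u ⟩
  (suc i + i) * u + u          ∎) (<⇒≱ (+-monoˡ-< u thin))
  where
  open ≤-Reasoning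
  0<u : ∀ u t → (suc i + i) * u < suc i * t → suc (suc i) * t ≤ (suc (suc i) + suc i) * u → 0 < u
  0<u (suc u) _ _ _ = z<s
  0<u zero zero h h′ rewrite *-zeroʳ (i + i) | *-zeroʳ i = contradiction h λ ()
  0<u zero (suc t) h h′ rewrite *-zeroʳ (i + suc i) = contradiction h′ λ ()
  -- Failure of the new bound forces this; by integrality it becomes `suc t ≤ 2 * u`, and with
  -- `u ≤ suc i` that contradicts the old bound.
  t<2u : t < 2 * u
  t<2u = *-cancelˡ-< (suc (suc i)) _ _ (begin-strict
    suc (suc i) * t                  ≤⟨ ≮⇒≥ ≮ ⟩
    (suc (suc i) + suc i) * u        <⟨ m<m+n _ (0<u u t thin (≮⇒≥ ≮)) ⟩
    (suc (suc i) + suc i) * u + u    ≡⟨ double i u ⟩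
    suc (suc i) * (2 * u)            ∎)
    where
    double : ∀ i u → (suc (suc i) + suc i) * u + u ≡ suc (suc i) * (2 * u)
    double = solve-∀
  split : ∀ i u → suc i * (2 * u) ≡ (suc i + i) * u + u
  split = solve-∀

-- The density threshold (i+1)/(2i+1) drops to (i+2)/(2i+3), but no set of at most i + 1 points lies
-- in between. So uniformity `j` earns the better ratio `j : i` with the same notion of sparseness.
sparse-lower : ∀ {i} (A : Subset n) → ∣ A ∣ ≤ suc i → Sparse (suc i) i A → Sparse (suc (suc i)) (suc i) A
sparse-lower {i = i} []      le p       = thin-lower {i} le p
sparse-lower {i = i} (x ∷ A) le (p , P) = thin-lower {i} le p , sparse-lower A (≤-trans (∣∷∣≤ x A) le) P

module _ (i : ℕ) where

  private
    j k : ℕ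
    j = suc i
    k = suc j

  expands-or-sparse⁻ : {F : Family n} → Uniform j F →
    j * size F ≤ i * size (∂ F) ⊎ ∃ λ A → F ∋ A × Sparse k j A
  expands-or-sparse⁻ U with expands-or-sparse j i j U
  ... | inj₁ p = inj₁ p
  ... | inj₂ (A , FA , sp) = inj₂ (A , FA , sparse-lower A (≤-reflexive (U A FA)) sp)

  -- Sections through the head are `j`-uniform and have the better ratio. Only the final stretch of
  -- at most 2k - 2 points has ratio `k : j`; since j² = i k + 1, it costs at most one unit for each
  -- of its at most C(2k-2, k) sets.
  expands-or-sparse⁺ : {F : Family n} → Uniform k F →
    j * j * size F ≤ j * i * size (∂ F) + L k i ⊎ ∃ λ A → F ∋ A × Sparse k j A
  expands-or-sparse⁺ {n} {F} U with k * suc n ≤? (k + j) * k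
  ... | yes le = inj₁ (begin
    j * j * s                  ≡⟨ square i s ⟩
    i * (k * s) + s            ≤⟨ +-mono-≤ (*-monoʳ-≤ i (lym U n≤k+i)) (size≤L k i U n≤k+i) ⟩
    i * (j * t) + L k i        ≡⟨ cong (_+ L k i) (trans (sym (*-assoc i j t)) (cong (_* t) (*-comm i j))) ⟩
    j * i * t + L k i          ∎)
    where
    open ≤-Reasoning
    s t : ℕ
    s = size F
    t = size (∂ F)
    n≤k+i : n ≤ k + i
    n≤k+i = ≤-pred (subst (suc n ≤_) (+-suc k i)
      (*-cancelˡ-≤ k (subst (k * suc n ≤_) (*-comm (k + j) k) le)))
    square : ∀ i s → suc i * suc i * s ≡ i * (suc (suc i) * s) + s
    square = solve-∀
  expands-or-sparse⁺ {zero} {F} U | no _ =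
    inj₁ (subst (_≤ j * i * size (∂ F) + L k i)
      (trans (sym (*-zeroʳ (j * j))) (cong (j * j *_) (sym (uniform>n⇒size≡0 {F = F} U z<s)))) z≤n)
  expands-or-sparse⁺ {suc n} {F} U | no ≰
    with expands-or-sparse⁺ (uniform-↾false U) | expands-or-sparse⁻ (uniform-↾true U)
  ... | inj₂ (A , FA , sp) | _ = inj₂ (false ∷ A , FA ,
          subst (λ m → (k + j) * m < k * suc (suc n)) (sym (U (false ∷ A) FA)) (≰⇒> ≰) , sp)
  ... | inj₁ _ | inj₂ (A , FA , sp) = inj₂ (true ∷ A , FA ,
          subst (λ m → (k + j) * m < k * suc (suc n)) (sym (U (true ∷ A) FA)) (≰⇒> ≰) , sp)
  ... | inj₁ p | inj₁ q = inj₁ (begin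
    j * j * (w + u)                          ≡⟨ expand j w u ⟩
    j * j * w + j * (j * u)                  ≤⟨ +-mono-≤ p (*-monoʳ-≤ j q) ⟩
    (j * i * ∂w + L k i) + j * (i * ∂u)      ≡⟨ collect j i ∂w ∂u (L k i) ⟩
    j * i * (∂w + ∂u) + L k i                ≤⟨ +-monoˡ-≤ (L k i) (*-monoʳ-≤ (j * i) (∂-↾-≤₂ F)) ⟩
    j * i * size (∂ F) + L k i               ∎)
    where
    open ≤-Reasoning
    w u ∂w ∂u : ℕ
    w = size (F ↾ false)
    u = size (F ↾ true)
    ∂w = size (∂ (F ↾ false))
    ∂u = size (∂ (F ↾ true))
    expand : ∀ j w u → j * j * (w + u) ≡ j * j * w + j * (j * u)
    expand = solve-∀
    collect : ∀ j i a b l → (j * i * a + l) + j * (i * b) ≡ j * i * (a + b) + l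
    collect = solve-∀

  cross-expands⁺ : {K H : Family n} → Uniform k K → Uniform j H → Cross K H → Bad H →
    j * j * size K ≤ j * i * size (∂ K) + L k i
  cross-expands⁺ {K = K} UK UH X bad with cross-shifted UH X bad
  ... | K′ , eq , le , U , ns with expands-or-sparse⁺ (U UK)
  ...   | inj₁ p = subst (λ s → j * j * s ≤ j * i * size (∂ K) + L k i) eq (≤-trans p (+-monoˡ-≤ (L k i) (*-monoʳ-≤ (j * i) le)))
  ...   | inj₂ (A , KA , sp) = contradiction sp (ns A KA)

-- Links and deletions

-- Both remain families on all `n` points, with members avoiding `i`, so they can be iterated and
-- summed over points.
lk dl : Fin n → Family n → Family n
lk zero    F (false ∷ A) = F (true ∷ A)
lk zero    F (true ∷ A)  = false
lk (suc i) F (x ∷ A)     = lk i (F ↾ x) A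
dl zero    F (false ∷ A) = F (false ∷ A)
dl zero    F (true ∷ A)  = false
dl (suc i) F (x ∷ A)     = dl i (F ↾ x) A

size-∅ : ∀ n → size {n} (λ _ → false) ≡ 0
size-∅ zero    = refl
size-∅ (suc n) = cong₂ _+_ (size-∅ n) (size-∅ n)

size-lk-zero : (F : Family (suc n)) → size (lk zero F) ≡ size (F ↾ true)
size-lk-zero {n} F = trans (cong (size (F ↾ true) +_) (size-∅ n)) (+-identityʳ _)

size-dl-zero : (F : Family (suc n)) → size (dl zero F) ≡ size (F ↾ false)
size-dl-zero {n} F = trans (cong (size (F ↾ false) +_) (size-∅ n)) (+-identityʳ _)

size-lk-dl : ∀ i (F : Family n) → size (lk i F) + size (dl i F) ≡ size F
size-lk-dl zero F = trans (cong₂ _+_ (size-lk-zero F) (size-dl-zero F)) (+-comm (size (F ↾ true)) _)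
size-lk-dl (suc i) F = trans (interchange +-commutativeSemigroup (size (lk i (F ↾ false))) _ _ _)
  (cong₂ _+_ (size-lk-dl i (F ↾ false)) (size-lk-dl i (F ↾ true)))

lk-mono : ∀ i {F G : Family n} → F ⊑ G → lk i F ⊑ lk i G
lk-mono zero    F⊑G (false ∷ A) h = F⊑G _ h
lk-mono (suc i) F⊑G (x ∷ A)     h = lk-mono i (λ B → F⊑G (x ∷ B)) A h

dl-mono : ∀ i {F G : Family n} → F ⊑ G → dl i F ⊑ dl i G
dl-mono zero    F⊑G (false ∷ A) h = F⊑G _ h
dl-mono (suc i) F⊑G (x ∷ A)     h = dl-mono i (λ B → F⊑G (x ∷ B)) A h

lk-∨ : ∀ i (F G : Family n) A → lk i (λ B → F B ∨ G B) A ≡ lk i F A ∨ lk i G A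
lk-∨ zero    F G (false ∷ A) = refl
lk-∨ zero    F G (true ∷ A)  = refl
lk-∨ (suc i) F G (x ∷ A)     = lk-∨ i (F ↾ x) (G ↾ x) A

∂-∅ : (A : Subset n) → ¬ ∂ (λ _ → false) ∋ A
∂-∅ (true ∷ A)  h = ∂-∅ A h
∂-∅ (false ∷ A) h = [ ∂-∅ A , (λ ()) ]′ (∂-elim (λ _ → false) A h)

∂-lk : ∀ i (F : Family n) → ∂ (lk i F) ⊑ lk i (∂ F)
∂-lk zero F (true ∷ A) h = contradiction h (∂-∅ A)
∂-lk zero F (false ∷ A) h = [ (λ q → q) , (λ ()) ]′ (∂-elim (lk zero F) A h)
∂-lk (suc i) F (true ∷ A) h = ∂-lk i (F ↾ true) A h
∂-lk (suc i) F (false ∷ A) h = [ (λ q → lk-mono i (∂-there F) A (∂-lk i (F ↾ false) A q))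
                               , (λ q → lk-mono i (∂-here F) A q) ]′ (∂-elim (lk (suc i) F) A h)

lk-∂ : ∀ i (F : Family n) → lk i (∂ F) ⊑ ∂ (lk i F)
lk-∂ zero F (false ∷ A) h = ∂-there (lk zero F) A h
lk-∂ (suc i) F (true ∷ A) h = lk-∂ i (F ↾ true) A h
lk-∂ (suc i) F (false ∷ A) h =
  [ (λ q → ∂-there (lk (suc i) F) A (lk-∂ i (F ↾ false) A q)) , ∂-here (lk (suc i) F) A ]′
    (∨-elim (trans (sym (lk-∨ i (∂ (F ↾ false)) (F ↾ true) A)) h))

∂-dl : ∀ i (F : Family n) → ∂ (dl i F) ⊑ dl i (∂ F)
∂-dl zero F (true ∷ A) h = contradiction h (∂-∅ A)
∂-dl zero F (false ∷ A) h = [ ∂-there F A , (λ ()) ]′ (∂-elim (dl zero F) A h)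
∂-dl (suc i) F (true ∷ A) h = ∂-dl i (F ↾ true) A h
∂-dl (suc i) F (false ∷ A) h = [ (λ q → dl-mono i (∂-there F) A (∂-dl i (F ↾ false) A q))
                               , (λ q → dl-mono i (∂-here F) A q) ]′ (∂-elim (dl (suc i) F) A h)

-- The two shadows lie in the link and the deletion of `∂ F`, whose sizes add up to that of `∂ F`.
size-∂-lk-dl : ∀ i (F : Family n) → size (∂ (lk i F)) + size (∂ (dl i F)) ≤ size (∂ F)
size-∂-lk-dl i F = ≤-trans (+-mono-≤ (size-mono (∂-lk i F)) (size-mono (∂-dl i F)))
  (≤-reflexive (size-lk-dl i (∂ F)))

lk-∋ : ∀ i (F : Family n) A → lk i F ∋ A → F ∋ (A [ i ]≔ true) × lookup A i ≡ false
lk-∋ zero    F (false ∷ A) h = h , refl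
lk-∋ (suc i) F (x ∷ A)     h = lk-∋ i (F ↾ x) A h

dl-∋ : ∀ i (F : Family n) A → dl i F ∋ A → F ∋ A × lookup A i ≡ false
dl-∋ zero    F (false ∷ A) h = h , refl
dl-∋ (suc i) F (x ∷ A)     h = dl-∋ i (F ↾ x) A h

∣insert∣ : ∀ i (A : Subset n) → lookup A i ≡ false → ∣ A [ i ]≔ true ∣ ≡ suc ∣ A ∣
∣insert∣ zero    (false ∷ A) e = refl
∣insert∣ (suc i) (false ∷ A) e = ∣insert∣ i A e
∣insert∣ (suc i) (true ∷ A)  e = cong suc (∣insert∣ i A e)

lk-uniform : ∀ i {k} {F : Family n} → Uniform (suc k) F → Uniform k (lk i F)
lk-uniform i {F = F} U A h =
  let h′ , e = lk-∋ i F A h in suc-injective (trans (sym (∣insert∣ i A e)) (U _ h′))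

dl-uniform : ∀ i {k} {F : Family n} → Uniform k F → Uniform k (dl i F)
dl-uniform i {F = F} U A h = U A (proj₁ (dl-∋ i F A h))

disjoint-sym : (A B : Subset n) → Disjoint A B → Disjoint B A
disjoint-sym A B D x p q = D x q p

disjoint-insert : ∀ i (A B : Subset n) → lookup A i ≡ false → Disjoint A B → Disjoint A (B [ i ]≔ true)
disjoint-insert i A B e D x Ax Bx with x ≟ i
... | yes refl = contradiction (trans (sym Ax) e) λ ()
... | no x≢i = D x Ax (trans (sym (lookup∘update′ x≢i B true)) Bx)

cross-sym : {F G : Family n} → Cross F G → Cross G F
cross-sym X A B GA FB D = X B A FB GA (disjoint-sym A B D)

cross-dl-lk : ∀ i {F G : Family n} → Cross F G → Cross (dl i F) (lk i G)
cross-dl-lk i {F} {G} X A B FA GB D =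
  let FA′ , e = dl-∋ i F A FA
      GB′ , _ = lk-∋ i G B GB
  in X A (B [ i ]≔ true) FA′ GB′ (disjoint-insert i A B e D)

-- The sets regain the distinct points `j` and `i`, each missing from the other set, so a common
-- point must come from the original pair.
cross-dl-lk₂ : ∀ i j {F G : Family n} → i ≢ j → Cross F G → Cross (dl i (lk j F)) (dl j (lk i G))
cross-dl-lk₂ i j {F} {G} i≢j X A B FA GB D =
  let FA′ , Ai = dl-∋ i (lk j F) A FA
      FA″ , _  = lk-∋ j F A FA′
      GB′ , Bj = dl-∋ j (lk i G) B GB
      GB″ , _  = lk-∋ i G B GB′
      B′       = B [ i ]≔ true
      Bj′      = trans (lookup∘update′ (i≢j ∘ sym) B true) Bj
  in X (A [ j ]≔ true) (B [ i ]≔ true) FA″ GB″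
       (disjoint-sym B′ (A [ j ]≔ true) (disjoint-insert j B′ A Bj′
         (disjoint-sym A B′ (disjoint-insert i A B Ai D))))

-- Sums over the points

∑ : (Fin n → ℕ) → ℕ
∑ {zero}  f = 0
∑ {suc n} f = f zero + ∑ (f ∘ suc)

∑-cong : {f g : Fin n → ℕ} → (∀ i → f i ≡ g i) → ∑ f ≡ ∑ g
∑-cong {zero}  e = refl
∑-cong {suc n} e = cong₂ _+_ (e zero) (∑-cong (e ∘ suc))

∑-mono : {f g : Fin n → ℕ} → (∀ i → f i ≤ g i) → ∑ f ≤ ∑ g
∑-mono {zero}  e = z≤n
∑-mono {suc n} e = +-mono-≤ (e zero) (∑-mono (e ∘ suc))

∑-+ : (f g : Fin n → ℕ) → ∑ (λ i → f i + g i) ≡ ∑ f + ∑ g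
∑-+ {zero}  f g = refl
∑-+ {suc n} f g = trans (cong (f zero + g zero +_) (∑-+ (f ∘ suc) (g ∘ suc))) (interchange +-commutativeSemigroup (f zero) _ _ _)

∑-* : ∀ c (f : Fin n → ℕ) → ∑ (λ i → c * f i) ≡ c * ∑ f
∑-* {zero}  c f = sym (*-zeroʳ c)
∑-* {suc n} c f = trans (cong (c * f zero +_) (∑-* c (f ∘ suc))) (sym (*-distribˡ-+ c (f zero) _))

∑-const : ∀ n c → ∑ {n} (λ _ → c) ≡ n * c
∑-const zero    c = refl
∑-const (suc n) c = cong (c +_) (∑-const n c)

∑-lk : ∀ r {F : Family n} → Uniform r F → ∑ (λ i → size (lk i F)) ≡ r * size F
∑-lk {zero} zero U = refl
∑-lk {zero} (suc r) {F} U rewrite uniform>n⇒size≡0 {F = F} U z<s = sym (*-zeroʳ r)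
∑-lk {suc n} r {F} U = trans (cong₂ _+_ (size-lk-zero F)
    (trans (∑-+ (λ i → size (lk i (F ↾ false))) _) (cong (_+ ∑ (λ i → size (lk i (F ↾ true)))) (∑-lk r (uniform-↾false U)))))
  (true-part r U)
  where
  w u : ℕ
  w = size (F ↾ false)
  u = size (F ↾ true)
  true-part : ∀ r → Uniform r F → u + (r * w + ∑ (λ i → size (lk i (F ↾ true)))) ≡ r * (w + u)
  true-part zero U
    rewrite ∑-lk 0 {F ↾ true} (λ A h → contradiction h (uniform-0-↾true {F = F} U A))
    | uniform-0-size-↾true U = refl
  true-part (suc r) U rewrite ∑-lk r (uniform-↾true U) = regroup r w u
    where
    regroup : ∀ r w u → u + (suc r * w + r * u) ≡ suc r * (w + u)
    regroup = solve-∀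

-- A set survives deletion of exactly the points that it misses; the additive form avoids n - r.
∑-dl : ∀ r {F : Family n} → Uniform r F → r * size F + ∑ (λ i → size (dl i F)) ≡ n * size F
∑-dl {n} r {F} U = begin
  r * size F + ∑ (λ i → size (dl i F))                      ≡⟨ cong (_+ ∑ (λ i → size (dl i F))) (∑-lk r U) ⟨
  ∑ (λ i → size (lk i F)) + ∑ (λ i → size (dl i F))         ≡⟨ ∑-+ (λ i → size (lk i F)) _ ⟨
  ∑ (λ i → size (lk i F) + size (dl i F))                   ≡⟨ ∑-cong (λ i → size-lk-dl i F) ⟩
  ∑ {n} (λ _ → size F)                                      ≡⟨ ∑-const n (size F) ⟩
  n * size F                                                ∎
  where open ≡-Reasoning

∑-∂-dl : ∀ k {F : Family n} → Uniform (suc k) F →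
  k * size (∂ F) + ∑ (λ i → size (∂ (dl i F))) ≤ n * size (∂ F)
∑-∂-dl k {F} U = ≤-trans (+-monoʳ-≤ (k * size (∂ F)) (∑-mono λ i → size-mono (∂-dl i F)))
  (≤-reflexive (∑-dl k (∂-uniform U)))

∑-∂-lk : ∀ k {F : Family n} → Uniform (suc k) F → k * size (∂ F) ≤ ∑ (λ i → size (∂ (lk i F)))
∑-∂-lk k {F} U = ≤-trans (≤-reflexive (sym (∑-lk k (∂-uniform U)))) (∑-mono λ i → size-mono (lk-∂ i F))

-- Comparison with the links, shadows and cardinalities of the statement

link≡lk : ∀ (F : Family n) i A → link F i A ≡ lk i F A
link≡lk F zero (true ∷ A)  = refl
link≡lk F zero (false ∷ A) = cong (λ B → F (true ∷ B)) (∪-identityʳ A)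
link≡lk F (suc i) (x ∷ A)     = trans (cong₂ (λ b y → not b ∧ F (y ∷ (A ∪ ⁅ i ⁆))) suc∈? (∨-identityʳ x))
  (link≡lk (F ↾ x) i A)
  where
  suc∈? : ⌊ suc i ∈? (x ∷ A) ⌋ ≡ ⌊ i ∈? A ⌋
  suc∈? with i ∈? A
  ... | yes _ = refl
  ... | no  _ = refl

∂⇒lk : ∀ (F : Family n) A → ∂ F ∋ A → ∃ λ i → lk i F ∋ A
∂⇒lk F (true ∷ A) h = let i , q = ∂⇒lk (F ↾ true) A h in suc i , q
∂⇒lk F (false ∷ A) h with ∂-elim F A h
... | inj₁ p = let i , q = ∂⇒lk (F ↾ false) A p in suc i , q
... | inj₂ p = zero , p

any-tabulate : ∀ {A : Set} (p : A → Bool) (f : Fin n → A) i → p (f i) ≡ true → any p (tabulate f) ≡ true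
any-tabulate p f zero    e = ∨-introˡ e
any-tabulate p f (suc i) e = ∨-introʳ {p (f zero)} (any-tabulate p (f ∘ suc) i e)

∂⊑shadow : (F : Family n) → ∂ F ⊑ shadow F
∂⊑shadow F A h =
  let i , q = ∂⇒lk F A h in any-tabulate (λ x → link F x A) (λ x → x) i (trans (link≡lk F i A) q)

length-filter-map : ∀ {A B : Set} (p : B → Bool) (f : A → B) xs →
  length (filter (λ y → p y ≡? true) (map f xs)) ≡ length (filter (λ x → p (f x) ≡? true) xs)
length-filter-map p f [] = refl
length-filter-map p f (x ∷ xs) with p (f x)
... | true  = cong suc (length-filter-map p f xs)
... | false = length-filter-map p f xs

card≡size : (F : Family n) → card F ≡ size F
card≡size {zero} F with F []
... | true  = refl
... | false = refl
card≡size {suc n} F = begin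
  length (filter P (map (false ∷_) S ++ map (true ∷_) S))
    ≡⟨ cong length (filter-++ P (map (false ∷_) S) _) ⟩
  length (filter P (map (false ∷_) S) ++ filter P (map (true ∷_) S))
    ≡⟨ length-++ (filter P (map (false ∷_) S)) ⟩
  length (filter P (map (false ∷_) S)) + length (filter P (map (true ∷_) S))
    ≡⟨ cong₂ _+_ (length-filter-map F (false ∷_) S) (length-filter-map F (true ∷_) S) ⟩
  card (F ↾ false) + card (F ↾ true)
    ≡⟨ cong₂ _+_ (card≡size (F ↾ false)) (card≡size (F ↾ true)) ⟩
  size F ∎
  where
  open ≡-Reasoning
  S = allSubsets n
  P = λ A → F A ≡? true

link-bad : ∀ {F : Family n} {i} → card (shadow (link F i)) < card (link F i) → Bad (lk i F)
link-bad {F = F} {i} lt = begin-strict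
  size (∂ (lk i F))            ≤⟨ size-mono (λ A h → ∂⊑shadow (link F i) A (∂-mono lk⊑link A h)) ⟩
  size (shadow (link F i))     ≡⟨ card≡size (shadow (link F i)) ⟨
  card (shadow (link F i))     <⟨ lt ⟩
  card (link F i)              ≡⟨ card≡size (link F i) ⟩
  size (link F i)              ≤⟨ size-mono (λ A h → trans (sym (link≡lk F i A)) h) ⟩
  size (lk i F)                ∎
  where
  open ≤-Reasoning
  lk⊑link : lk i F ⊑ link F i
  lk⊑link A h = trans (link≡lk F i A) h

crossIntersecting⇒cross : {F G : Family n} → CrossIntersecting F G → Cross F G
crossIntersecting⇒cross X A B FA GB D =
  let x , x∈A∩B = X A B FA GB
      x∈A , x∈B = x∈p∩q⁻ A B x∈A∩B
  in D x ([]=⇒lookup x∈A) ([]=⇒lookup x∈B)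

-- Double counting

∑-swap : ∀ {m n} (f : Fin m → Fin n → ℕ) → ∑ (λ u → ∑ (f u)) ≡ ∑ (λ v → ∑ (λ u → f u v))
∑-swap {zero} {n} f = sym (trans (∑-const n 0) (*-zeroʳ n))
∑-swap {suc m} f = trans (cong (∑ (f zero) +_) (∑-swap (f ∘ suc))) (sym (∑-+ (f zero) _))

-- The extra `c` pays for the uncontrolled term at `u`.
∑-≥-off : ∀ {c} (f : Fin n → ℕ) u → (∀ v → u ≢ v → c ≤ f v) → n * c ≤ c + ∑ f
∑-≥-off {suc n} {c} f zero h = +-monoʳ-≤ c (≤-trans (≤-reflexive (sym (∑-const n c)))
  (≤-trans (∑-mono (λ v → h (suc v) λ ())) (m≤n+m _ (f zero))))
∑-≥-off {suc n} {c} f (suc u) h = +-monoʳ-≤ c (≤-trans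
  (∑-≥-off (f ∘ suc) u (λ v u≢v → h (suc v) λ { refl → u≢v refl }))
  (+-monoˡ-≤ _ (h zero λ ())))

LinksBad : Family n → Set
LinksBad {n} F = ∀ (i : Fin n) → Bad (lk i F)

module _ {c N} {F : Family (suc c + N)} (U : Uniform (suc c) F) where

  ∑-size-dl : ∑ (λ i → size (dl i F)) ≡ N * size F
  ∑-size-dl = +-cancelˡ-≡ (suc c * size F) _ _
    (trans (∑-dl (suc c) U) (*-distribʳ-+ (size F) (suc c) N))

  -- A member of `F` misses `N` points, so a shadow set, one point smaller, misses `suc N`.
  ∑-size-∂-dl : ∑ (λ i → size (∂ (dl i F))) ≤ suc N * size (∂ F)
  ∑-size-∂-dl = +-cancelˡ-≤ (c * size (∂ F)) _ _ (≤-trans (∑-∂-dl c U) (≤-reflexive (split c N _)))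
    where
    split : ∀ c N s → (suc c + N) * s ≡ c * s + suc N * s
    split = solve-∀

  module _ (bad : LinksBad F) where

    size-∂-≤ : c * size (∂ F) ≤ suc c * size F
    size-∂-≤ = ≤-trans (∑-∂-lk c U)
      (≤-trans (∑-mono λ i → <⇒≤ (bad i)) (≤-reflexive (∑-lk (suc c) U)))

    0<size : 0 < size F
    0<size = <-≤-trans (≤-<-trans z≤n (bad zero))
      (≤-trans (m≤m+n _ _) (≤-reflexive (size-lk-dl zero F)))

module _ {k b} {F G : Family n} (UF : Uniform k F) (UG : Uniform (suc b) G) (X : Cross F G)
  (badG : LinksBad G) where

  -- Each deletion of `F` cross-intersects the bad, `b`-uniform link of `G` at the same point.
  ∑-dl-expands : suc b * ∑ (λ i → size (dl i F)) ≤ b * ∑ (λ i → size (∂ (dl i F)))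
  ∑-dl-expands = begin
    suc b * ∑ (λ i → size (dl i F))       ≡⟨ ∑-* (suc b) (λ i → size (dl i F)) ⟨
    ∑ (λ i → suc b * size (dl i F))       ≤⟨ ∑-mono (λ i → cross-expands
        (lk-uniform i UG) (cross-dl-lk i X) (badG i) (dl-uniform i UF)) ⟩
    ∑ (λ i → b * size (∂ (dl i F)))       ≡⟨ ∑-* b (λ i → size (∂ (dl i F))) ⟩
    b * ∑ (λ i → size (∂ (dl i F)))       ∎
    where open ≤-Reasoning

-- With k - ℓ = e + 1, the summed inequalities give (b+1)(k-1) N ≤ b k (N+1). As (b+1)(k-1) exceeds
-- b k by 1 + e, this bounds N. For k = ℓ that excess would vanish, hence the separate treatment.
unequal : ∀ {b e N} {F G : Family (suc (suc b + e) + N)} →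
  Uniform (suc (suc b + e)) F → Uniform (suc b) G → Cross F G → LinksBad F → LinksBad G →
  N ≤ suc (suc b + e) * b
unequal {b} {e} {N} {F} {G} UF UG X badF badG = +-cancelˡ-≤ (b * k * N) _ _ (begin
  b * k * N + N                     ≤⟨ +-monoʳ-≤ (b * k * N) (m≤m+n N (e * N)) ⟩
  b * k * N + (N + e * N)           ≡⟨ split b e N ⟩
  suc b * c * N                     ≤⟨ *-cancelʳ-≤ _ _ φ {{>-nonZero (0<size UF badF)}} times-φ ⟩
  b * suc N * k                     ≡⟨ expand b N k ⟩
  b * k * N + k * b                 ∎)
  where
  open ≤-Reasoning
  c k φ s : ℕ
  c = suc b + e
  k = suc c
  φ = size F
  s = size (∂ F)
  split : ∀ b e N → b * suc (suc b + e) * N + (N + e * N) ≡ suc b * (suc b + e) * N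
  split = solve-∀
  expand : ∀ b N k → b * suc N * k ≡ b * k * N + k * b
  expand = solve-∀
  reorder₁ : ∀ b c N φ → suc b * c * N * φ ≡ c * (suc b * (N * φ))
  reorder₁ = solve-∀
  reorder₂ : ∀ b c N s → c * (b * (suc N * s)) ≡ b * suc N * (c * s)
  reorder₂ = solve-∀
  times-φ : suc b * c * N * φ ≤ b * suc N * k * φ
  times-φ = begin
    suc b * c * N * φ                                ≡⟨ reorder₁ b c N φ ⟩
    c * (suc b * (N * φ))                            ≡⟨ cong (λ x → c * (suc b * x)) (∑-size-dl UF) ⟨
    c * (suc b * ∑ (λ i → size (dl i F)))            ≤⟨ *-monoʳ-≤ c (∑-dl-expands UF UG X badG) ⟩
    c * (b * ∑ (λ i → size (∂ (dl i F))))            ≤⟨ *-monoʳ-≤ c (*-monoʳ-≤ b (∑-size-∂-dl UF)) ⟩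
    c * (b * (suc N * s))                            ≡⟨ reorder₂ b c N s ⟩
    b * suc N * (c * s)                              ≤⟨ *-monoʳ-≤ (b * suc N) (size-∂-≤ UF badF) ⟩
    b * suc N * (k * φ)                              ≡⟨ *-assoc (b * suc N) k φ ⟨
    b * suc N * k * φ                                ∎

-- The links of `G` are 0-uniform, so the expansion factor is 0 and every deletion of the nonempty
-- `F` is empty.
equal-1 : ∀ {N} {F G : Family (suc N)} →
  Uniform 1 F → Uniform 1 G → Cross F G → LinksBad F → LinksBad G → N ≤ 0
equal-1 {N} {F} UF UG X badF badG = *-cancelʳ-≤ N 0 (size F) {{>-nonZero (0<size UF badF)}}
  (≤-trans (≤-reflexive (trans (sym (∑-size-dl UF)) (sym (*-identityˡ _)))) (∑-dl-expands UF UG X badG))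

-- Equal uniformities at least two

L-step : ∀ i → L (suc i) (suc i) ≤ 4 * L i i
L-step i = begin
  L i (suc i) + L (suc i) i     ≡⟨ cong (L i (suc i) +_) (*-cancelˡ-≡ _ _ (suc i) (L-absorb i i)) ⟩
  L i (suc i) + L i (suc i)     ≤⟨ +-mono-≤ (half i) (half i) ⟩
  2 * L i i + 2 * L i i         ≡⟨ double (L i i) ⟩
  4 * L i i                     ∎
  where
  open ≤-Reasoning
  double : ∀ x → 2 * x + 2 * x ≡ 4 * x
  double = solve-∀
  half : ∀ i → L i (suc i) ≤ 2 * L i i
  half zero    = s≤s z≤n
  half (suc i) = ≤-trans (+-monoˡ-≤ (L (suc i) (suc i)) below)
    (+-monoʳ-≤ (L (suc i) (suc i)) (≤-reflexive (sym (+-identityʳ _))))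
    where
    below : L i (suc (suc i)) ≤ L (suc i) (suc i)
    below = *-cancelˡ-≤ (suc i) (≤-trans (*-monoˡ-≤ (L i (suc (suc i))) (n≤1+n (suc i)))
      (≤-reflexive (sym (L-absorb i (suc i)))))

-- Sizes of link and deletion add up exactly while their shadows are subadditive, so a deficit must
-- sit in one of the two.
bad-dl : ∀ v (H : Family n) → Bad H → ¬ Bad (lk v H) → Bad (dl v H)
bad-dl v H bad ¬bad = +-cancelˡ-< (size (lk v H)) _ _ (begin-strict
  size (lk v H) + size (∂ (dl v H))          ≤⟨ +-monoˡ-≤ _ (≮⇒≥ ¬bad) ⟩
  size (∂ (lk v H)) + size (∂ (dl v H))      ≤⟨ size-∂-lk-dl v H ⟩
  size (∂ H)                                 <⟨ bad ⟩
  size H                                     ≡⟨ size-lk-dl v H ⟨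
  size (lk v H) + size (dl v H)              ∎)
  where open ≤-Reasoning

module Equal (i : ℕ) where

  j k : ℕ
  j = suc i
  k = suc j

  -- A link of at most C(2i, i) sets loses only the ratio `i : j`, while the deletion gains `k : j`.
  -- Badness of `H` then forces the link to be at least half of `H`, and `H` has at least C(2j, j) /
  -- 2 members.
  large-link : {H : Family n} → Uniform j H → Bad H → ∀ v →
    k * size (dl v H) ≤ j * size (∂ (dl v H)) → L j j ≤ 4 * size (lk v H)
  large-link {H = H} U bad v expands with size (lk v H) ≤? L i i
  ... | no f≰L = ≤-trans (L-step i) (*-monoʳ-≤ 4 (<⇒≤ (≰⇒> f≰L)))
  ... | yes f≤L = begin
    L j j            ≤⟨ bad⇒L≤2*size j U bad ⟩
    2 * x            ≤⟨ *-monoʳ-≤ 2 x≤2f ⟩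
    2 * (2 * f)      ≡⟨ *-assoc 2 2 f ⟨
    4 * f            ∎
    where
    open ≤-Reasoning
    x f f̄ ∂f ∂f̄ : ℕ
    x = size H
    f = size (lk v H)
    f̄ = size (dl v H)
    ∂f = size (∂ (lk v H))
    ∂f̄ = size (∂ (dl v H))
    x≤2f : x ≤ 2 * f
    x≤2f = +-cancelʳ-≤ (i * f + j * x) _ _ (begin
      x + (i * f + j * x)               ≤⟨ +-monoʳ-≤ x (+-monoˡ-≤ (j * x) (kruskal-katona i i (lk-uniform v U) f≤L)) ⟩
      x + (j * ∂f + j * x)              ≡⟨ regroup i x ∂f ⟩
      k * x + j * ∂f                    ≡⟨ cong (λ z → k * z + j * ∂f) (size-lk-dl v H) ⟨
      k * (f + f̄) + j * ∂f              ≡⟨ cong (_+ j * ∂f) (*-distribˡ-+ k f f̄) ⟩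
      k * f + k * f̄ + j * ∂f            ≤⟨ +-monoˡ-≤ (j * ∂f) (+-monoʳ-≤ (k * f) expands) ⟩
      k * f + j * ∂f̄ + j * ∂f           ≡⟨ regroup′ i f ∂f ∂f̄ ⟩
      2 * f + (i * f + j * (∂f + ∂f̄))   ≤⟨ +-monoʳ-≤ (2 * f) (+-monoʳ-≤ (i * f)
                                             (*-monoʳ-≤ j (≤-trans (size-∂-lk-dl v H) (<⇒≤ bad)))) ⟩
      2 * f + (i * f + j * x)           ∎)
      where
      regroup : ∀ i x y → x + (suc i * y + suc i * x) ≡ suc (suc i) * x + suc i * y
      regroup = solve-∀
      regroup′ : ∀ i f y z → suc (suc i) * f + suc i * z + suc i * y ≡ 2 * f + (i * f + suc i * (y + z))
      regroup′ = solve-∀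

  module _ {F G : Family n} (UF : Uniform k F) (UG : Uniform k G) (X : Cross F G)
    (badF : LinksBad F) (badG : LinksBad G) where

    large-pair : ∀ u v → u ≢ v → L j j ≤ 4 * (size (lk u (lk v F)) + size (lk v (lk u G)))
    large-pair u v u≢v
      with size (∂ (lk u (lk v F))) <? size (lk u (lk v F)) | size (∂ (lk v (lk u G))) <? size (lk v (lk u G))
    ... | yes f-bad | yes g-bad = begin
      L j j                    ≤⟨ L-step i ⟩
      4 * L i i                ≡⟨ double (L i i) ⟩
      2 * (L i i + L i i)      ≤⟨ *-monoʳ-≤ 2 (+-mono-≤
          (bad⇒L≤2*size i (lk-uniform u (lk-uniform v UF)) f-bad)
          (bad⇒L≤2*size i (lk-uniform v (lk-uniform u UG)) g-bad)) ⟩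
      2 * (2 * f + 2 * g)      ≡⟨ double′ f g ⟩
      4 * (f + g)              ∎
      where
      open ≤-Reasoning
      f g : ℕ
      f = size (lk u (lk v F))
      g = size (lk v (lk u G))
      double : ∀ x → 4 * x ≡ 2 * (x + x)
      double = solve-∀
      double′ : ∀ x y → 2 * (2 * x + 2 * y) ≡ 4 * (x + y)
      double′ = solve-∀
    -- Since `lk u G` is bad and its link at `v` is not, its deletion at `v` is bad; this makes the
    -- deletion of `lk v F` at `u` expand.
    ... | _ | no g-good = ≤-trans
      (large-link (lk-uniform v UF) (badF v) u (cross-expands
        (dl-uniform v (lk-uniform u UG)) (cross-dl-lk₂ u v u≢v X)
        (bad-dl v (lk u G) (badG u) g-good) (dl-uniform u (lk-uniform v UF))))
      (*-monoʳ-≤ 4 (m≤m+n (size (lk u (lk v F))) _))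
    ... | no f-good | yes _ = ≤-trans
      (large-link (lk-uniform u UG) (badG u) v (cross-expands
        (dl-uniform u (lk-uniform v UF)) (cross-sym (cross-dl-lk₂ u v u≢v X))
        (bad-dl u (lk v F) (badF v) f-good) (dl-uniform v (lk-uniform u UG))))
      (*-monoʳ-≤ 4 (m≤n+m _ (size (lk u (lk v F)))))

    pairs : n * (n * L j j) ≤ n * L j j + 4 * (j * k * (size F + size G))
    pairs = begin
      n * (n * L j j)                                    ≡⟨ ∑-const n (n * L j j) ⟨
      ∑ {n} (λ _ → n * L j j)                            ≤⟨ ∑-mono (λ u → ∑-≥-off (a u) u (large-pair u)) ⟩
      ∑ (λ u → L j j + ∑ (a u))                          ≡⟨ ∑-+ (λ _ → L j j) (λ u → ∑ (a u)) ⟩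
      ∑ {n} (λ _ → L j j) + ∑ (λ u → ∑ (a u))            ≡⟨ cong₂ _+_ (∑-const n (L j j)) total ⟩
      n * L j j + 4 * (j * k * (size F + size G))        ∎
      where
      open ≤-Reasoning
      f g a : Fin n → Fin n → ℕ
      f u v = size (lk u (lk v F))
      g u v = size (lk v (lk u G))
      a u v = 4 * (f u v + g u v)
      ∑∑g : {H : Family n} → Uniform k H → ∑ (λ u → ∑ (λ v → size (lk v (lk u H)))) ≡ j * k * size H
      ∑∑g {H} UH = trans (∑-cong (λ u → ∑-lk j (lk-uniform u UH)))
        (trans (∑-* j (λ u → size (lk u H))) (trans (cong (j *_) (∑-lk k UH)) (sym (*-assoc j k (size H)))))
      total : ∑ (λ u → ∑ (a u)) ≡ 4 * (j * k * (size F + size G))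
      total = trans (∑-cong (λ u → trans (∑-* 4 (λ v → f u v + g u v)) (cong (4 *_) (∑-+ (f u) (g u)))))
        (trans (∑-* 4 (λ u → ∑ (f u) + ∑ (g u)))
        (cong (4 *_) (trans (∑-+ (λ u → ∑ (f u)) (λ u → ∑ (g u)))
          (trans (cong₂ _+_ (trans (∑-swap f) (∑∑g UF)) (∑∑g UG))
                 (sym (*-distribˡ-+ (j * k) (size F) (size G)))))))

  -- Here M is n - k² + k. Summing `cross-expands⁺` over all points, the identity j² = i k + 1
  -- leaves M |F| against the n additive errors C(2k-2, k).
  size-bound : ∀ {M} {F G : Family (k + (i * k + M))} → Uniform k F → Uniform k G → Cross F G →
    LinksBad F → LinksBad G → M * size F ≤ (k + (i * k + M)) * L k i
  size-bound {M} {F} {G} UF UG X badF badG = +-cancelˡ-≤ (i * k * φ + i * k * N * φ) _ _ (begin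
    i * k * φ + i * k * N * φ + M * φ                      ≡⟨ collect i M φ ⟩
    j * j * (N * φ)                                        ≡⟨ cong (j * j *_) (∑-size-dl UF) ⟨
    j * j * ∑ (λ v → size (dl v F))                        ≡⟨ ∑-* (j * j) (λ v → size (dl v F)) ⟨
    ∑ (λ v → j * j * size (dl v F))                        ≤⟨ ∑-mono (λ v → cross-expands⁺ i
        (dl-uniform v UF) (lk-uniform v UG) (cross-dl-lk v X) (badG v)) ⟩
    ∑ (λ v → j * i * size (∂ (dl v F)) + L k i)            ≡⟨ ∑-+ (λ v → j * i * size (∂ (dl v F))) (λ _ → L k i) ⟩
    ∑ (λ v → j * i * size (∂ (dl v F))) + ∑ {m} (λ _ → L k i)   ≡⟨ cong₂ _+_
        (∑-* (j * i) (λ v → size (∂ (dl v F)))) (∑-const m (L k i)) ⟩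
    j * i * ∑ (λ v → size (∂ (dl v F))) + m * L k i        ≤⟨ +-monoˡ-≤ (m * L k i) (*-monoʳ-≤ (j * i) (∑-size-∂-dl UF)) ⟩
    j * i * (suc N * s) + m * L k i                        ≡⟨ cong (_+ m * L k i) (reorder i N s) ⟩
    i * suc N * (j * s) + m * L k i                        ≤⟨ +-monoˡ-≤ (m * L k i) (*-monoʳ-≤ (i * suc N) (size-∂-≤ UF badF)) ⟩
    i * suc N * (k * φ) + m * L k i                        ≡⟨ cong (_+ m * L k i) (expand i N φ) ⟩
    i * k * φ + i * k * N * φ + m * L k i                  ∎)
    where
    open ≤-Reasoning
    N m φ s : ℕ
    N = i * k + M
    m = k + N
    φ = size F
    s = size (∂ F)
    collect : ∀ i M φ → i * (2 + i) * φ + i * (2 + i) * (i * (2 + i) + M) * φ + M * φ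
                        ≡ (1 + i) * (1 + i) * ((i * (2 + i) + M) * φ)
    collect = solve-∀
    reorder : ∀ i N s → (1 + i) * i * ((1 + N) * s) ≡ i * (1 + N) * ((1 + i) * s)
    reorder = solve-∀
    expand : ∀ i N φ → i * (1 + N) * ((2 + i) * φ) ≡ i * (2 + i) * φ + i * (2 + i) * N * φ
    expand = solve-∀

  cube : ¬ (suc k * (k * k) ≤ 8 * (j * j))
  cube le = <⇒≱ (<-≤-trans (m<m+n (i * i * i) z<s) i³+4≤i²) (i²≤i³ i)
    where
    i²≤i³ : ∀ i → i * i ≤ i * i * i
    i²≤i³ zero    = z≤n
    i²≤i³ (suc i) = m≤m*n _ (suc i)
    identity : ∀ i → i * i * i + 4 + 8 * ((1 + i) * (1 + i)) ≡ (3 + i) * ((2 + i) * (2 + i)) + i * i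
    identity = solve-∀
    i³+4≤i² : i * i * i + 4 ≤ i * i
    i³+4≤i² = +-cancelʳ-≤ (8 * (j * j)) _ _ (≤-trans (≤-reflexive (identity i))
      (≤-trans (+-monoˡ-≤ (i * i) le) (≤-reflexive (+-comm _ (i * i)))))

  equal : ∀ {q} {F G : Family (k + (i * k + (suc k + q)))} → Uniform k F → Uniform k G → Cross F G →
    ¬ (LinksBad F × LinksBad G)
  equal {q} {F} {G} UF UG X (badF , badG) = cube (begin
    suc k * (k * k)      ≤⟨ *-mono-≤ (m≤m+n (suc k) q) k²≤m ⟩
    M * m                ≤⟨ *-cancelʳ-≤ (M * m) (8 * (j * j)) (suc m * Q)
                              {{>-nonZero (*-mono-≤ (s≤s (z≤n {m})) (0<L j j))}} scaled ⟩
    8 * (j * j)          ∎)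
    where
    open ≤-Reasoning
    M m Q φ γ : ℕ
    -- The number of points is `suc m`, equal to k² + 1 + q; thus M ≥ k + 1 and m ≥ k², which feed
    -- `cube`.
    M = suc k + q
    m = j + (i * k + M)
    Q = L j j
    φ = size F
    γ = size G
    k²≤m : k * k ≤ m
    k²≤m = ≤-trans (m≤m+n (k * k) q) (≤-reflexive (identity i q))
      where
      identity : ∀ i q → (2 + i) * (2 + i) + q ≡ 1 + i + (i * (2 + i) + (3 + i + q))
      identity = solve-∀
    pairs′ : m * (suc m * Q) ≤ 4 * (j * k * (φ + γ))
    pairs′ = +-cancelˡ-≤ (suc m * Q) _ _ (pairs UF UG X badF badG)
    scaled : M * m * (suc m * Q) ≤ 8 * (j * j) * (suc m * Q)
    scaled = begin
      M * m * (suc m * Q)                          ≡⟨ *-assoc M m _ ⟩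
      M * (m * (suc m * Q))                        ≤⟨ *-monoʳ-≤ M pairs′ ⟩
      M * (4 * (j * k * (φ + γ)))                  ≡⟨ reorder M j k φ γ ⟩
      4 * (j * k) * (M * φ + M * γ)                ≤⟨ *-monoʳ-≤ (4 * (j * k)) (+-mono-≤
          (size-bound UF UG X badF badG) (size-bound UG UF (cross-sym X) badG badF)) ⟩
      4 * (j * k) * (suc m * L k i + suc m * L k i)  ≡⟨ reorder′ j k (suc m) (L k i) ⟩
      -- Absorption turns k C(2k-2, k) into (k-1) C(2k-2, k-1), so the central binomial coefficient
      -- `Q` cancels.
      8 * j * suc m * (k * L k i)                  ≡⟨ cong (8 * j * suc m *_) (L-absorb j i) ⟩
      8 * j * suc m * (j * Q)                      ≡⟨ reorder″ j (suc m) Q ⟩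
      8 * (j * j) * (suc m * Q)                    ∎
      where
      reorder : ∀ M j k φ γ → M * (4 * (j * k * (φ + γ))) ≡ 4 * (j * k) * (M * φ + M * γ)
      reorder = solve-∀
      reorder′ : ∀ j k m l → 4 * (j * k) * (m * l + m * l) ≡ 8 * j * m * (k * l)
      reorder′ = solve-∀
      reorder″ : ∀ j m q → 8 * j * m * (j * q) ≡ 8 * (j * j) * (m * q)
      reorder″ = solve-∀

-- Case distinction on the uniformities and conclusion

all-bad⇒⊥-> : ∀ {b e} → suc (suc b + e) * suc b < n →
  {F G : Family n} → Uniform (suc (suc b + e)) F → Uniform (suc b) G → Cross F G →
  LinksBad F → LinksBad G → ⊥
all-bad⇒⊥-> {b = b} {e} kℓ<n with m≤n⇒∃[o]m+o≡n kℓ<n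
... | q , refl = go
  where
  k : ℕ
  k = suc (suc b + e)
  go : {F G : Family (suc (k * suc b) + q)} → Uniform k F → Uniform (suc b) G → Cross F G →
    LinksBad F → LinksBad G → ⊥
  go = subst (λ n → {F G : Family n} → Uniform k F → Uniform (suc b) G → Cross F G →
    LinksBad F → LinksBad G → ⊥) (identity k b q)
    -- Writing n as k + N gives N = k b + 1 + q, just above the bound k b of `unequal`.
    (λ UF UG X badF badG → contradiction (unequal {b} {e} UF UG X badF badG) (<⇒≱ (s≤s (m≤m+n (k * b) q))))
    where
    identity : ∀ k b q → k + (suc (k * b) + q) ≡ suc (k * suc b) + q
    identity = solve-∀

all-bad⇒⊥-≡ : ∀ c → suc c * suc c < n →
  {F G : Family n} → Uniform (suc c) F → Uniform (suc c) G → Cross F G →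
  LinksBad F → LinksBad G → ⊥
all-bad⇒⊥-≡ {suc n} zero (s≤s 1≤n) UF UG X badF badG = <⇒≱ 1≤n (equal-1 UF UG X badF badG)
all-bad⇒⊥-≡ (suc i) k²<n with m≤n⇒∃[o]m+o≡n k²<n
... | q , refl = go
  where
  k : ℕ
  k = suc (suc i)
  go : {F G : Family (suc (k * k) + q)} → Uniform k F → Uniform k G → Cross F G →
    LinksBad F → LinksBad G → ⊥
  go = subst (λ n → {F G : Family n} → Uniform k F → Uniform k G → Cross F G →
    LinksBad F → LinksBad G → ⊥) (identity i q)
    (λ UF UG X badF badG → Equal.equal i {q} UF UG X (badF , badG))
    where
    identity : ∀ i q → 2 + i + (i * (2 + i) + (3 + i + q)) ≡ suc ((2 + i) * (2 + i)) + q
    identity = solve-∀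

all-bad⇒⊥ : ∀ k ℓ → .{{NonZero k}} → .{{NonZero ℓ}} → k * ℓ < n →
  {F G : Family n} → Uniform k F → Uniform ℓ G → Cross F G → LinksBad F → LinksBad G → ⊥
all-bad⇒⊥ (suc c) (suc b) kℓ<n UF UG X badF badG with <-cmp c b
... | tri≈ _ refl _ = all-bad⇒⊥-≡ c kℓ<n UF UG X badF badG
... | tri> _ _ b<c with m≤n⇒∃[o]m+o≡n b<c
...   | e , refl = all-bad⇒⊥-> {e = e} kℓ<n UF UG X badF badG
all-bad⇒⊥ {n} (suc c) (suc b) kℓ<n UF UG X badF badG | tri< c<b _ _ with m≤n⇒∃[o]m+o≡n c<b
...   | e , refl = all-bad⇒⊥-> {e = e} (subst (_< n) (*-comm (suc c) (suc b)) kℓ<n) UG UF (cross-sym X) badG badF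

theorem1p4 : (n k ℓ : ℕ) → .{{NonZero n}} → .{{NonZero k}} → .{{NonZero ℓ}} →
    k * ℓ < n →
    (𝓕 𝓖 : Family n) → Uniform k 𝓕 → Uniform ℓ 𝓖 → CrossIntersecting 𝓕 𝓖 →
    ∃ λ (i : Fin n) →
    (card (shadow (link 𝓕 i)) ≥ card (link 𝓕 i))
    ⊎ (card (shadow (link 𝓖 i)) ≥ card (link 𝓖 i))
theorem1p4 n k ℓ kℓ<n 𝓕 𝓖 U𝓕 U𝓖 X
  with any? (λ i → (card (link 𝓕 i) ≤? card (shadow (link 𝓕 i)))
                   ⊎-dec (card (link 𝓖 i) ≤? card (shadow (link 𝓖 i))))
... | yes p = p
... | no ¬p = ⊥-elim
  (all-bad⇒⊥ k ℓ kℓ<n U𝓕 U𝓖 (crossIntersecting⇒cross X)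
    (λ i → link-bad {F = 𝓕} {i} (≰⇒> λ le → ¬p (i , inj₁ le)))
    (λ i → link-bad {F = 𝓖} {i} (≰⇒> λ le → ¬p (i , inj₂ le))))
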